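{- $\mathsf{FO(LFP)}$ cannot define all problems that are in $\mathrm{PTIME}$ and closed under substructures: there is an isomorphism-closed class of finite structures over a finite vocabulary that is decidable in polynomial time and closed under substructures but is not the class of finite models of any $\mathsf{FO(LFP)}$ sentence.
   Context: A class of structures is closed under substructures if whenever $\mathbf A$ belongs to it, every substructure of $\mathbf A$ belongs to it. $\mathsf{FO(LFP)}$ is first-order logic extended with the least fixed-point operator. -}

module Defs where

open import Data.Nat using (ℕ; zero; suc; _+_; _*_; _^_)
open import Data.Fin using (Fin; zero; suc; splitAt; _≟_)
open import Data.Vec using (Vec; []; _∷_; lookup)
import Data.Vec as Vec
open import Data.List using (List; []; _∷_; _++_; length; replicate; concat; concatMap; allFin)
import Data.List as List
open import Data.Bool using (Bool; true; false; if_then_else_; _∨_; not)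
open import Data.Product using (Σ; _×_; _,_; proj₁; proj₂; ∃)
open import Data.Sum using (_⊎_; [_,_])
open import Data.Unit using (⊤)
open import Data.Empty using (⊥)
open import Relation.Nullary using (¬_; does)
open import Relation.Binary.PropositionalEquality using (_≡_; _≢_)
open import Function using (_∘_)
open import Function.Bundles using (_↔_; Inverse; _⇔_)
open import Function.Definitions using (Injective)

record Vocab : Set where
  field
    nsym  : ℕ
    arity : Fin nsym → ℕ
open Vocab public

record Str (σ : Vocab) (n : ℕ) : Set where
  field
    rel : (i : Fin (nsym σ)) → Vec (Fin n) (arity σ i) → Bool
open Str public

Class : Vocab → Set₁
Class σ = ∀ {n} → Str σ n → Set

Iso : ∀ {σ n m} → Str σ n → Str σ m → Set
Iso {σ} {n} {m} A B =
  Σ (Fin n ↔ Fin m) λ f →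
    ∀ (i : Fin (nsym σ)) (as : Vec (Fin n) (arity σ i)) →
      rel A i as ≡ rel B i (Vec.map (Inverse.to f) as)

IsoClosed : ∀ {σ} → Class σ → Set
IsoClosed {σ} K = ∀ {n m} (A : Str σ n) (B : Str σ m) → Iso A B → K A → K B

Embedding : ∀ {σ m n} → Str σ m → Str σ n → Set
Embedding {σ} {m} {n} B A =
  Σ (Fin m → Fin n) λ f → Injective _≡_ _≡_ f ×
    (∀ (i : Fin (nsym σ)) (bs : Vec (Fin m) (arity σ i)) →
      rel B i bs ≡ rel A i (Vec.map f bs))

SubstructureClosed : ∀ {σ} → Class σ → Set
SubstructureClosed {σ} K =
  ∀ {n m} (A : Str σ n) (B : Str σ m) → Embedding B A → K A → K B

-- Syntax of FO(LFP)
-- v : number of free first-order variables (de Bruijn),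
-- Γ : arities of the free second-order (fixed-point) relation variables.

data Fm (σ : Vocab) : (v : ℕ) → List ℕ → Set
OnlyPol : ∀ {σ v Γ} → Bool → Fin (length Γ) → Fm σ v Γ → Set

data Fm σ where
  atom : ∀ {v Γ} (i : Fin (nsym σ)) → Vec (Fin v) (arity σ i) → Fm σ v Γ
  rvar : ∀ {v Γ} (j : Fin (length Γ)) → Vec (Fin v) (List.lookup Γ j) → Fm σ v Γ
  eq   : ∀ {v Γ} → Fin v → Fin v → Fm σ v Γ
  neg  : ∀ {v Γ} → Fm σ v Γ → Fm σ v Γ
  and  : ∀ {v Γ} → Fm σ v Γ → Fm σ v Γ → Fm σ v Γ
  or   : ∀ {v Γ} → Fm σ v Γ → Fm σ v Γ → Fm σ v Γ
  ex   : ∀ {v Γ} → Fm σ (suc v) Γ → Fm σ v Γ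
  all  : ∀ {v Γ} → Fm σ (suc v) Γ → Fm σ v Γ
  -- [lfp_{R, x₁…x_k} φ](t₁,…,t_k): φ has k new first-order variables
  -- (the first k de Bruijn indices) and the new relation variable R
  -- (index zero) of arity k, which must occur only positively in φ.
  lfp  : ∀ {v Γ} (k : ℕ) (φ : Fm σ (k + v) (k ∷ Γ)) →
         OnlyPol true zero φ → Vec (Fin v) k → Fm σ v Γ

-- OnlyPol p x φ : every occurrence of relation variable x in φ is under
-- an even (p = true) resp. odd (p = false) number of negations.

OnlyPol p x (atom i ts)      = ⊤
OnlyPol p x (rvar j ts)     = if p then ⊤ else (j ≢ x)
OnlyPol p x (eq s t)        = ⊤
OnlyPol p x (neg φ)         = OnlyPol (not p) x φ
OnlyPol p x (and φ ψ)       = OnlyPol p x φ × OnlyPol p x ψ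
OnlyPol p x (or φ ψ)        = OnlyPol p x φ × OnlyPol p x ψ
OnlyPol p x (ex φ)          = OnlyPol p x φ
OnlyPol p x (all φ)         = OnlyPol p x φ
OnlyPol p x (lfp k φ _ ts)  = OnlyPol p (suc x) φ

Sentence : Vocab → Set
Sentence σ = Fm σ 0 []

RelEnv : ℕ → List ℕ → Set
RelEnv n Γ = (j : Fin (length Γ)) → Vec (Fin n) (List.lookup Γ j) → Bool

extR : ∀ {n k Γ} → (Vec (Fin n) k → Bool) → RelEnv n Γ → RelEnv n (k ∷ Γ)
extR S R zero    = S
extR S R (suc j) = R j

extV : ∀ {n v} → Fin n → (Fin v → Fin n) → Fin (suc v) → Fin n
extV a ρ zero    = a
extV a ρ (suc x) = ρ x

-- Satisfaction; the least fixed point is the intersection of all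
-- (pre)fixed points of the (monotone) operator induced by φ.
Sat : ∀ {σ n v Γ} → Str σ n → Fm σ v Γ → (Fin v → Fin n) → RelEnv n Γ → Set
Sat A (atom i ts)    ρ R = rel A i (Vec.map ρ ts) ≡ true
Sat A (rvar j ts)   ρ R = R j (Vec.map ρ ts) ≡ true
Sat A (eq s t)      ρ R = ρ s ≡ ρ t
Sat A (neg φ)       ρ R = ¬ Sat A φ ρ R
Sat A (and φ ψ)     ρ R = Sat A φ ρ R × Sat A ψ ρ R
Sat A (or φ ψ)      ρ R = Sat A φ ρ R ⊎ Sat A ψ ρ R
Sat {n = n} A (ex φ)  ρ R = Σ (Fin n) λ a → Sat A φ (extV a ρ) R
Sat {n = n} A (all φ) ρ R = ∀ (a : Fin n) → Sat A φ (extV a ρ) R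
Sat {n = n} A (lfp k φ _ ts) ρ R =
  ∀ (S : Vec (Fin n) k → Bool) →
    (∀ (as : Vec (Fin n) k) →
       Sat A φ ([ lookup as , ρ ] ∘ splitAt k) (extR S R) → S as ≡ true) →
    S (Vec.map ρ ts) ≡ true

_⊨_ : ∀ {σ n} → Str σ n → Sentence σ → Set
A ⊨ φ = Sat A φ (λ ()) (λ ())

FOLFPDefinable : ∀ {σ} → Class σ → Set
FOLFPDefinable {σ} K =
  Σ (Sentence σ) λ φ → ∀ {n} (A : Str σ n) → K A ⇔ (A ⊨ φ)

data Move : Set where
  left right stay : Move

-- Tape alphabet Fin (3 + extra): 0 = blank, 1 = bit 0, 2 = bit 1.
record TM : Set where
  field
    nstates : ℕ
    extra   : ℕ
    start   : Fin nstates
    accept  : Fin nstates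
    reject  : Fin nstates
    δ       : Fin nstates → Fin (3 + extra) → Fin nstates × Fin (3 + extra) × Move
open TM public

record Config (M : TM) : Set where
  constructor config
  field
    state : Fin (nstates M)
    head  : ℕ
    tape  : ℕ → Fin (3 + extra M)
open Config public

halted : (M : TM) → Fin (nstates M) → Bool
halted M q = does (q ≟ accept M) ∨ does (q ≟ reject M)

write : ∀ {A : Set} → (ℕ → A) → ℕ → A → ℕ → A
write t zero    b zero    = b
write t zero    b (suc j) = t (suc j)
write t (suc i) b zero    = t zero
write t (suc i) b (suc j) = write (t ∘ suc) i b j

move : Move → ℕ → ℕ
move left  zero    = zero
move left  (suc h) = h
move right h       = suc h
move stay  h       = h

step : (M : TM) → Config M → Config M
step M c with halted M (state c)
... | true  = c
... | false with δ M (state c) (tape c (head c))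
...   | (q , b , m) = config q (move m (head c)) (write (tape c) (head c) b)

run : (M : TM) → ℕ → Config M → Config M
run M zero    c = c
run M (suc t) c = run M t (step M c)

bitSym : ∀ {e} → Bool → Fin (3 + e)
bitSym false = suc zero
bitSym true  = suc (suc zero)

inputTape : ∀ {e} → List Bool → ℕ → Fin (3 + e)
inputTape []      i       = zero
inputTape (b ∷ w) zero    = bitSym b
inputTape (b ∷ w) (suc i) = inputTape w i

initConfig : (M : TM) → List Bool → Config M
initConfig M w = config (start M) zero (inputTape w)

allTuples : (n k : ℕ) → List (Vec (Fin n) k)
allTuples n zero    = [] ∷ []
allTuples n (suc k) = concatMap (λ a → List.map (a ∷_) (allTuples n k)) (allFin n)

encode : ∀ {σ n} → Str σ n → List Bool
encode {σ} {n} A =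
  replicate n true ++ (false ∷
    concatMap (λ i → List.map (rel A i) (allTuples n (arity σ i))) (allFin (nsym σ)))

PTime : ∀ {σ} → Class σ → Set
PTime {σ} K =
  Σ TM λ M → Σ ℕ λ c → Σ ℕ λ d →
    ∀ {n} (A : Str σ n) →
      let w   = encode A
          fin = run M (c * length w ^ d + c) (initConfig M w)
      in (halted M (state fin) ≡ true) × (K A ⇔ (state fin ≡ accept M))

{-# OPTIONS --safe #-}
-- The class K consists of the structures, with a set U and a digraph E, on n elements in which
-- no vertex with a loop is reached from U by an E-walk of length ℓ with 2 (ℓ + 2) ≤ n.
-- Substructures have fewer walks and fewer elements, so K is closed under them.
--
-- A walk of m edges from U to a loop, padded with isolated elements, lies in K exactly when there
-- are fewer than m + 3 of these.  Since isolated elements are interchangeable, a formula with fewer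
-- quantified variables than isolated elements cannot count them: a pebble-game argument, carried
-- out directly on the impredicative semantics of lfp, shows that no formula separates m + 2 from
-- m + 3 of them if m is at least its width.
--
-- Membership in K is decided by breadth-first search, run for n / 2 rounds.
module Submission where

open import Defs
open import Data.Bool using (Bool; true; false; not; _∧_; _∨_)
import Data.Bool.Properties as Bool
open import Data.Empty using (⊥; ⊥-elim)
open import Data.Fin as Fin using (Fin; zero; suc; toℕ; fromℕ<; splitAt; _↑ˡ_; _↑ʳ_; #_; combine; remQuot)
import Data.Fin.Properties as Fin
open import Data.List as List
  using (List; []; _∷_; length; _++_; _ʳ++_; map; concatMap; allFin; replicate)
import Data.List.Properties as List
open import Data.List.Membership.Propositional using (_∈_)
open import Data.List.Membership.Propositional.Properties using (∈-allFin)
open import Data.List.Relation.Unary.All as All using (All; []; _∷_)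
import Data.List.Relation.Unary.All.Properties as All
open import Data.List.Relation.Unary.Any using (Any; here; there)
import Data.List.Relation.Unary.Any.Properties as Any
open import Data.Nat
open import Data.Nat.Properties
open import Data.Nat.Solver using (module +-*-Solver)
open import Data.Product using (Σ; ∃; ∃₂; _×_; _,_; proj₁; proj₂; map₂)
open import Data.Sum as Sum using (_⊎_; inj₁; inj₂; [_,_])
open import Data.Vec as Vec using (Vec; []; _∷_; lookup)
import Data.Vec.Properties as Vec
open import Function using (_∘_; id)
open import Function.Bundles using (_⇔_; mk⇔; Equivalence; Inverse)
open import Relation.Binary.PropositionalEquality hiding ([_])
open import Relation.Nullary using (¬_; Dec; yes; no; does; contradiction)
open import Relation.Nullary.Decidable
  using (_×-dec_; _⊎-dec_; _→-dec_; dec-true; map′; ¬?; decidable-stable)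

-- A shortest walk to a vertex has fewer than `n` edges, so a bound of the form ℓ < n would merely
-- forbid loops reachable from `U`, which least fixed points express. The factor 2 makes the
-- admissible length depend on the number of elements off the walk: fixed points can compare walk
-- lengths with each other, but not with the size of a set of interchangeable elements. The summand
-- 2 fits the search: its round 1 only enters `U`, and a loop is tested one round after its vertex
-- is entered, so a vertex at distance ℓ is tested in round ℓ + 2. The obstacle in the pebble
-- argument is that the body of a fixed point has a free relation variable, whose values on the two
-- structures must be compared as well. Since `Sat` quantifies over all prefixed points, there are
-- no stages to follow; instead the values are linked by a one-way transfer along similar tuples, in
-- the direction given by the polarity of the variable.

pattern 𝟎 = zero
pattern 𝟏 = suc zero

-- The class and its closure properties

σ : Vocab
σ = record { nsym = 2 ; arity = λ { 𝟎 → 1 ; 𝟏 → 2 } }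

module _ {n} (A : Str σ n) where

  U : Fin n → Bool
  U x = rel A 𝟎 (x ∷ [])

  E : Fin n → Fin n → Bool
  E x y = rel A 𝟏 (x ∷ y ∷ [])

data Reach {n} (A : Str σ n) : ℕ → Fin n → Set where
  source : ∀ {x} → U A x ≡ true → Reach A 0 x
  edge   : ∀ {ℓ x y} → Reach A ℓ x → E A x y ≡ true → Reach A (suc ℓ) y

K : Class σ
K {n} A = ∀ ℓ x → 2 * (2 + ℓ) ≤ n → Reach A ℓ x → E A x x ≡ true → ⊥

K-substructureClosed : SubstructureClosed (λ {n} → K {n})
K-substructureClosed A B (f , f-inj , f-rel) kA ℓ x 2ℓ≤m r e =
  kA ℓ (f x) (≤-trans 2ℓ≤m (Fin.injective⇒≤ f-inj)) (image r)
     (trans (sym (f-rel 𝟏 _)) e)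
  where
  image : ∀ {ℓ x} → Reach B ℓ x → Reach A ℓ (f x)
  image (source u) = source (trans (sym (f-rel 𝟎 _)) u)
  image (edge r e) = edge (image r) (trans (sym (f-rel 𝟏 _)) e)

iso⇒embedding : ∀ {σ n m} {A : Str σ n} {B : Str σ m} → Iso A B → Embedding B A
iso⇒embedding {B = B} (f , f-rel) =
  Inverse.from f ,
  (λ {x} {y} fx≡fy → trans (sym (Inverse.strictlyInverseˡ f x))
                        (trans (cong (Inverse.to f) fx≡fy) (Inverse.strictlyInverseˡ f y))) ,
  λ i bs → trans (cong (rel B i) (sym (to-from bs))) (sym (f-rel i _))
  where
  to-from : ∀ {k} (bs : Vec _ k) → Vec.map (Inverse.to f) (Vec.map (Inverse.from f) bs) ≡ bs
  to-from bs = trans (sym (Vec.map-∘ _ _ bs))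
                     (trans (Vec.map-cong (Inverse.strictlyInverseˡ f) bs) (Vec.map-id bs))

K-isoClosed : IsoClosed (λ {n} → K {n})
K-isoClosed A B iso = K-substructureClosed A B (iso⇒embedding iso)

-- Undefinability

infixr 5 _⊕_

_⊕_ : ∀ {n k v} → Vec (Fin n) k → (Fin v → Fin n) → Fin (k + v) → Fin n
_⊕_ {k = k} as ρ = [ lookup as , ρ ] ∘ splitAt k

-- Relation variables range over `Bool`-valued relations, so the prefixed point that is pulled back
-- in the fixed-point case must be decided by a search through all tuples.
allVec? : ∀ {n} k {P : Vec (Fin n) k → Set} → (∀ as → Dec (P as)) → Dec (∀ as → P as)
allVec? zero    P? = map′ (λ { p [] → p }) (λ h → h []) (P? [])
allVec? (suc k) P? = map′ (λ { h (a ∷ as) → h a as }) (λ h a as → h (a ∷ as))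
                          (Fin.all? λ a → allVec? k (λ as → P? (a ∷ as)))

-- A bound on the number of variables in scope at any quantifier.
width : ∀ {σ v Γ} → Fm σ v Γ → ℕ
width (atom _ _)       = 0
width (rvar _ _)       = 0
width (eq _ _)         = 0
width (neg φ)          = width φ
width (and φ ψ)        = width φ ⊔ width ψ
width (or φ ψ)         = width φ ⊔ width ψ
width (ex {v} φ)       = v ⊔ width φ
width (all {v} φ)      = v ⊔ width φ
width (lfp _ φ _ _)    = width φ

-- Lassos with isolated elements

module _ (m : ℕ) where

  -- The position of an element on the path v₀ → … → vₘ; isolated elements all get suc m.
  pos : ∀ {q} → Fin (suc m + q) → ℕ
  pos x = toℕ x ⊓ suc m

  -- The bound `j ≤ m` matters at `i ≡ m`: the isolated elements, at position `suc m`, must not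
  -- become successors of the last vertex.
  Step : ℕ → ℕ → Set
  Step i j = (j ≡ suc i × j ≤ m) ⊎ (i ≡ m × j ≡ m)

  step? : ∀ i j → Dec (Step i j)
  step? i j = ((j ≟ suc i) ×-dec (j ≤? m)) ⊎-dec ((i ≟ m) ×-dec (j ≟ m))

  lasso : ∀ q → Str σ (suc m + q)
  lasso q = record { rel = λ { 𝟎 (x ∷ []) → does (pos {q} x ≟ 0)
                             ; 𝟏 (x ∷ y ∷ []) → does (step? (pos {q} x) (pos {q} y)) } }

  does⇒ : ∀ {P : Set} (P? : Dec P) → does P? ≡ true → P
  does⇒ (yes p) _ = p

  step⇒≤ : ∀ {i j} → Step i j → j ≤ suc i
  step⇒≤ (inj₁ (refl , _))    = ≤-refl
  step⇒≤ (inj₂ (refl , refl)) = n≤1+n _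

  step-loop : ∀ {i} → Step i i → i ≡ m
  step-loop (inj₁ (i≡1+i , _)) = ⊥-elim (1+n≢n (sym i≡1+i))
  step-loop (inj₂ (i≡m , _))   = i≡m

  reach⇒pos≤ : ∀ {q ℓ x} → Reach (lasso q) ℓ x → pos {q} x ≤ ℓ
  reach⇒pos≤ {q} {x = x} (source u) = ≤-reflexive (does⇒ (pos {q} x ≟ 0) u)
  reach⇒pos≤ {q} (edge {x = x} {y} r e) =
    ≤-trans (step⇒≤ (does⇒ (step? (pos {q} x) (pos {q} y)) e)) (s≤s (reach⇒pos≤ r))

  vertex : ∀ q i → i ≤ m → Fin (suc m + q)
  vertex q i i≤m = fromℕ< (<-≤-trans (s≤s i≤m) (m≤m+n (suc m) q))

  pos-vertex : ∀ q i i≤m → pos {q} (vertex q i i≤m) ≡ i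
  pos-vertex q i i≤m =
    trans (cong (_⊓ suc m) (Fin.toℕ-fromℕ< _)) (m≤n⇒m⊓n≡m (m≤n⇒m≤1+n i≤m))

  reach-vertex : ∀ q i i≤m → Reach (lasso q) i (vertex q i i≤m)
  reach-vertex q zero    i≤m = source refl
  reach-vertex q (suc i) i≤m = edge (reach-vertex q i (<⇒≤ i≤m))
    (dec-true (step? _ _) (inj₁ (trans (pos-vertex q (suc i) i≤m) (cong suc (sym (pos-vertex q i (<⇒≤ i≤m))))
                                , ≤-trans (≤-reflexive (pos-vertex q (suc i) i≤m)) i≤m)))

  loop-vertex : ∀ q → E (lasso q) (vertex q m ≤-refl) (vertex q m ≤-refl) ≡ true
  loop-vertex q = dec-true (step? _ _) (inj₂ (pos-vertex q m ≤-refl , pos-vertex q m ≤-refl))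

  lasso∈K : K (lasso (2 + m))
  lasso∈K ℓ x 2ℓ≤n r e = <-irrefl refl (≤-trans 2ℓ<2m 2ℓ≤n)
    where
    m≤ℓ : m ≤ ℓ
    m≤ℓ = ≤-trans (≤-reflexive (sym (step-loop (does⇒ (step? _ _) e)))) (reach⇒pos≤ r)
    2ℓ<2m : suc m + (2 + m) < 2 * (2 + ℓ)
    2ℓ<2m = ≤-trans (≤-reflexive (cong (2 + m +_) (sym (+-identityʳ (2 + m)))))
              (*-monoʳ-≤ 2 (+-monoʳ-≤ 2 m≤ℓ))

  lasso∉K : ¬ K (lasso (3 + m))
  lasso∉K k = k m (vertex _ m ≤-refl)
    (≤-reflexive (trans (cong (2 + m +_) (+-identityʳ (2 + m))) (sym (+-suc (suc m) (2 + m)))))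
    (reach-vertex _ m ≤-refl) (loop-vertex _)

  -- The constraint that two pebble pairs (a , a′) and (b , b′) impose on a position.
  Compatible : ∀ {q q′} (a : Fin (suc m + q)) (a′ : Fin (suc m + q′))
               (b : Fin (suc m + q)) (b′ : Fin (suc m + q′)) → Set
  Compatible {q} {q′} a a′ b b′ =
    pos {q} a ≡ pos {q′} a′ × (a ≡ b → a′ ≡ b′) × (a′ ≡ b′ → a ≡ b)

  Sim : ∀ {q q′ v} → (Fin v → Fin (suc m + q)) → (Fin v → Fin (suc m + q′)) → Set
  Sim {q} {q′} ρ ρ′ = ∀ x y → Compatible {q} {q′} (ρ x) (ρ′ x) (ρ y) (ρ′ y)

  Sim-sym : ∀ {q q′ v} {ρ : Fin v → Fin (suc m + q)} {ρ′ : Fin v → Fin (suc m + q′)} →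
            Sim {q} {q′} ρ ρ′ → Sim {q′} {q} ρ′ ρ
  Sim-sym s x y with s x y
  ... | p , f , g = sym p , g , f

  Sim? : ∀ {q q′ v} (ρ : Fin v → Fin (suc m + q)) (ρ′ : Fin v → Fin (suc m + q′)) →
         Dec (Sim {q} {q′} ρ ρ′)
  Sim? {q} {q′} ρ ρ′ = Fin.all? λ x → Fin.all? λ y →
    (pos {q} (ρ x) ≟ pos {q′} (ρ′ x)) ×-dec
    ((ρ x Fin.≟ ρ y) →-dec (ρ′ x Fin.≟ ρ′ y)) ×-dec
    ((ρ′ x Fin.≟ ρ′ y) →-dec (ρ x Fin.≟ ρ y))

  -- Every pebble pair of `τ` and `τ′` is one of `ρ` and `ρ′`. Weakening below `⊕` and `extV` and
  -- the substitution of `ts` are all instances, so one monotonicity lemma for `Sim` serves every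
  -- change of environment.
  Covers : ∀ {N N′ v w : ℕ} → (Fin v → Fin N) → (Fin v → Fin N′) →
           (Fin w → Fin N) → (Fin w → Fin N′) → Set
  Covers ρ ρ′ τ τ′ = ∀ x → ∃ λ z → ρ z ≡ τ x × ρ′ z ≡ τ′ x

  Sim-mono : ∀ {q q′ v w} {ρ : Fin v → Fin (suc m + q)} {ρ′ : Fin v → Fin (suc m + q′)}
             {τ : Fin w → Fin (suc m + q)} {τ′ : Fin w → Fin (suc m + q′)} →
             Covers ρ ρ′ τ τ′ → Sim {q} {q′} ρ ρ′ → Sim {q} {q′} τ τ′
  Sim-mono {q} {q′} c s x y with c x | c y
  ... | z , p , p′ | t , r , r′ =
    subst₂ (λ a a′ → Compatible {q} {q′} a a′ _ _) p p′
      (subst₂ (Compatible {q} {q′} _ _) r r′ (s z t))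

  Covers-⊕ : ∀ {N N′ k v w} (as : Vec (Fin N) k) (as′ : Vec (Fin N′) k)
             {ρ : Fin v → Fin N} {ρ′ : Fin v → Fin N′} {τ : Fin w → Fin N} {τ′ : Fin w → Fin N′} →
             Covers ρ ρ′ τ τ′ → Covers (as ⊕ ρ) (as′ ⊕ ρ′) (as ⊕ τ) (as′ ⊕ τ′)
  Covers-⊕ {k = k} {v} {w} as as′ {ρ} {ρ′} c x with splitAt k {w} x
  ... | inj₁ y = y ↑ˡ v , cong [ lookup as , ρ ] (Fin.splitAt-↑ˡ k y v)
                        , cong [ lookup as′ , ρ′ ] (Fin.splitAt-↑ˡ k y v)
  ... | inj₂ y with c y
  ...   | z , p , p′ = k ↑ʳ z
                     , trans (cong [ lookup as , ρ ] (Fin.splitAt-↑ʳ k v z)) p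
                     , trans (cong [ lookup as′ , ρ′ ] (Fin.splitAt-↑ʳ k v z)) p′

  Covers-right : ∀ {N N′ k v} (as : Vec (Fin N) k) (as′ : Vec (Fin N′) k)
                 {ρ : Fin v → Fin N} {ρ′ : Fin v → Fin N′} → Covers (as ⊕ ρ) (as′ ⊕ ρ′) ρ ρ′
  Covers-right {k = k} {v} as as′ {ρ} {ρ′} z =
    k ↑ʳ z , cong [ lookup as , ρ ] (Fin.splitAt-↑ʳ k v z)
           , cong [ lookup as′ , ρ′ ] (Fin.splitAt-↑ʳ k v z)

  Covers-map : ∀ {N N′ k v} (ts : Vec (Fin v) k) {ρ : Fin v → Fin N} {ρ′ : Fin v → Fin N′} →
               Covers ρ ρ′ (Vec.map ρ ts ⊕ ρ) (Vec.map ρ′ ts ⊕ ρ′)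
  Covers-map {k = k} {v} ts {ρ} {ρ′} x with splitAt k {v} x
  ... | inj₁ y = lookup ts y , sym (Vec.lookup-map y ρ ts) , sym (Vec.lookup-map y ρ′ ts)
  ... | inj₂ y = y , refl , refl

  -- The parameters take part in the similarity because a fixed point with free variables is
  -- invariant only relative to them. One inclusion is all that a pulled-back prefixed point can
  -- offer, hence the asymmetry.
  Transfers : ∀ {q q′ k v} (ρ : Fin v → Fin (suc m + q)) (ρ′ : Fin v → Fin (suc m + q′)) →
              (Vec (Fin (suc m + q)) k → Bool) → (Vec (Fin (suc m + q′)) k → Bool) → Set
  Transfers {q} {q′} ρ ρ′ S S′ =
    ∀ as as′ → Sim {q} {q′} (as ⊕ ρ) (as′ ⊕ ρ′) → S as ≡ true → S′ as′ ≡ true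

  SignedTransfers : ∀ {q q′ k v} → Bool → (ρ : Fin v → Fin (suc m + q)) (ρ′ : Fin v → Fin (suc m + q′)) →
                    (Vec (Fin (suc m + q)) k → Bool) → (Vec (Fin (suc m + q′)) k → Bool) → Set
  SignedTransfers {q} {q′} true  ρ ρ′ S S′ = Transfers {q} {q′} ρ ρ′ S S′
  SignedTransfers {q} {q′} false ρ ρ′ S S′ = Transfers {q′} {q} ρ′ ρ S′ S

  SignedTransfers-not : ∀ p {q q′ k v} {ρ : Fin v → Fin (suc m + q)} {ρ′ : Fin v → Fin (suc m + q′)}
                        {S : Vec (Fin (suc m + q)) k → Bool} {S′ : Vec (Fin (suc m + q′)) k → Bool} →
                        SignedTransfers {q} {q′} p ρ ρ′ S S′ →
                        SignedTransfers {q′} {q} (not p) ρ′ ρ S′ S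
  SignedTransfers-not true  h = h
  SignedTransfers-not false h = h

  -- More pebbles make similarity more demanding, so fewer pairs of tuples have to transfer. This
  -- carries the hypothesis on relation variables below a binder.
  SignedTransfers-mono : ∀ p {q q′ k v w}
    {ρ : Fin v → Fin (suc m + q)} {ρ′ : Fin v → Fin (suc m + q′)}
    {τ : Fin w → Fin (suc m + q)} {τ′ : Fin w → Fin (suc m + q′)}
    {S : Vec (Fin (suc m + q)) k → Bool} {S′ : Vec (Fin (suc m + q′)) k → Bool} →
    Covers ρ ρ′ τ τ′ → SignedTransfers {q} {q′} p τ τ′ S S′ → SignedTransfers {q} {q′} p ρ ρ′ S S′
  SignedTransfers-mono true {q} {q′} c h as as′ s =
    h as as′ (Sim-mono {q} {q′} (Covers-⊕ as as′ c) s)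
  SignedTransfers-mono false {q} {q′} c h as as′ s =
    h as as′ (Sim-mono {q′} {q} (Covers-⊕ as as′ (map₂ (λ (p , p′) → p′ , p) ∘ c)) s)

  Sim-extV : ∀ {q q′ v} {ρ : Fin v → Fin (suc m + q)} {ρ′ : Fin v → Fin (suc m + q′)} {a a′} →
             Sim {q} {q′} ρ ρ′ → pos {q} a ≡ pos {q′} a′ →
             (∀ x → (a ≡ ρ x → a′ ≡ ρ′ x) × (a′ ≡ ρ′ x → a ≡ ρ x)) →
             Sim {q} {q′} (extV a ρ) (extV a′ ρ′)
  Sim-extV s p f zero    zero    = p , (λ _ → refl) , (λ _ → refl)
  Sim-extV s p f zero    (suc y) = p , f y
  Sim-extV s p f (suc x) zero    = proj₁ (s x x) , sym ∘ proj₁ (f x) ∘ sym , sym ∘ proj₂ (f x) ∘ sym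
  Sim-extV s p f (suc x) (suc y) = s x y

  pos≤⇒toℕ≡ : ∀ {q} (x : Fin (suc m + q)) → pos {q} x ≤ m → toℕ x ≡ pos {q} x
  pos≤⇒toℕ≡ x p≤m with toℕ x ≤? suc m
  ... | yes x≤ = sym (m≤n⇒m⊓n≡m x≤)
  ... | no  x≰ = ⊥-elim (<-irrefl refl (≤-trans (≤-reflexive (sym (m≥n⇒m⊓n≡n (≰⇒≥ x≰)))) p≤m))

  pos≤-injective : ∀ {q} {x y : Fin (suc m + q)} → pos {q} x ≤ m → pos {q} x ≡ pos {q} y → x ≡ y
  pos≤-injective {q} {x} {y} p≤m p≡ = Fin.toℕ-injective
    (trans (pos≤⇒toℕ≡ x p≤m) (trans p≡ (sym (pos≤⇒toℕ≡ y (subst (_≤ m) p≡ p≤m)))))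

  -- Pigeonhole: if every isolated element were a value of `ρ`, choosing an index for each would
  -- inject `Fin q` into `Fin v`.
  fresh-isolated : ∀ {q v} → v < q → (ρ : Fin v → Fin (suc m + q)) →
                   ∃ λ a → pos {q} a ≡ suc m × ∀ x → a ≢ ρ x
  fresh-isolated {q} v<q ρ with Fin.any? (λ p → Fin.all? (λ x → ¬? ((suc m ↑ʳ p) Fin.≟ ρ x)))
  ... | yes (p , h) = suc m ↑ʳ p
                    , m≥n⇒m⊓n≡n (≤-trans (m≤m+n (suc m) (toℕ p)) (≤-reflexive (sym (Fin.toℕ-↑ʳ (suc m) p))))
                    , h
  ... | no ∄p = ⊥-elim (<⇒≱ v<q (Fin.injective⇒≤ {f = proj₁ ∘ hit} hit-injective))
    where
    hit : ∀ p → ∃ λ x → suc m ↑ʳ p ≡ ρ x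
    hit p = decidable-stable (Fin.any? λ x → (suc m ↑ʳ p) Fin.≟ ρ x)
                             (λ h → ∄p (p , λ x e → h (x , e)))
    hit-injective : ∀ {p r} → proj₁ (hit p) ≡ proj₁ (hit r) → p ≡ r
    hit-injective {p} {r} e = Fin.↑ʳ-injective (suc m) p r
      (trans (proj₂ (hit p)) (trans (cong ρ e) (sym (proj₂ (hit r)))))

  -- A pebbled element is answered by its partner, another path vertex by the vertex at the same
  -- position, and another isolated element by a fresh isolated one, for which `v < q′` leaves room.
  Sim-forth : ∀ {q q′ v} → v < q′ → {ρ : Fin v → Fin (suc m + q)} {ρ′ : Fin v → Fin (suc m + q′)} →
              Sim {q} {q′} ρ ρ′ → ∀ a → ∃ λ a′ → Sim {q} {q′} (extV a ρ) (extV a′ ρ′)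
  Sim-forth {q} {q′} v<q′ {ρ} {ρ′} s a with Fin.any? (λ x → ρ x Fin.≟ a)
  ... | yes (x , refl) = ρ′ x , Sim-extV {q} {q′} s (proj₁ (s x x)) (λ y → proj₂ (s x y))
  ... | no a∉ρ with pos {q} a ≤? m
  ...   | yes p≤m = a′ , Sim-extV {q} {q′} s p≡ λ x →
              (λ e → ⊥-elim (a∉ρ (x , sym e))) ,
              (λ e → pos≤-injective {q} p≤m
                       (trans p≡ (trans (cong (pos {q′}) e) (sym (proj₁ (s x x))))))
    where
    a′ = vertex q′ (pos {q} a) p≤m
    p≡ = sym (pos-vertex q′ (pos {q} a) p≤m)
  ...   | no p≰m with fresh-isolated v<q′ ρ′
  ...     | a′ , p′ , a′∉ρ′ = a′ , Sim-extV {q} {q′} s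
              (trans (≤-antisym (m⊓n≤n (toℕ a) (suc m)) (≰⇒> p≰m)) (sym p′))
              (λ x → (λ e → ⊥-elim (a∉ρ (x , sym e))) , (λ e → ⊥-elim (a′∉ρ′ x e)))

  Sim-back : ∀ {q q′ v} → v < q → {ρ : Fin v → Fin (suc m + q)} {ρ′ : Fin v → Fin (suc m + q′)} →
             Sim {q} {q′} ρ ρ′ → ∀ a′ → ∃ λ a → Sim {q} {q′} (extV a ρ) (extV a′ ρ′)
  Sim-back {q} {q′} v<q s a′ with Sim-forth {q′} {q} v<q (Sim-sym {q} {q′} s) a′
  ... | a , s′ = a , Sim-sym {q′} {q} s′

  Sim-atom : ∀ {q q′ v} {ρ : Fin v → Fin (suc m + q)} {ρ′ : Fin v → Fin (suc m + q′)} →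
             Sim {q} {q′} ρ ρ′ → ∀ i ts →
             rel (lasso q) i (Vec.map ρ ts) ≡ rel (lasso q′) i (Vec.map ρ′ ts)
  Sim-atom s 𝟎 (x ∷ [])     = cong (λ i → does (i ≟ 0)) (proj₁ (s x x))
  Sim-atom s 𝟏 (x ∷ y ∷ []) = cong₂ (λ i j → does (step? i j)) (proj₁ (s x x)) (proj₁ (s y y))

  -- Quantifiers place a pebble by `Sim-forth` or `Sim-back`. The fixed-point case treats all
  -- similar tuples at once and chooses none, so its `k` variables count towards `width` only at
  -- quantifiers below it. The transfer goes one way; a negation exchanges the structures and flips
  -- all signs.
  Sat-transfer : ∀ {q q′ v Γ} (φ : Fm σ v Γ) → width φ < q → width φ < q′ →
    (sign : Fin (length Γ) → Bool) → (∀ j → OnlyPol (sign j) j φ) →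
    ∀ {ρ ρ′} → Sim {q} {q′} ρ ρ′ →
    ∀ {R : RelEnv (suc m + q) Γ} {R′ : RelEnv (suc m + q′) Γ} →
    (∀ j → SignedTransfers {q} {q′} (sign j) ρ ρ′ (R j) (R′ j)) →
    Sat (lasso q) φ ρ R → Sat (lasso q′) φ ρ′ R′
  Sat-transfer (atom i ts) _ _ _ _ s _ h = trans (sym (Sim-atom s i ts)) h
  Sat-transfer {q} {q′} (rvar j ts) _ _ sign pol s t h with sign j | pol j | t j
  ... | true  | _   | tj = tj (Vec.map _ ts) (Vec.map _ ts) (Sim-mono {q} {q′} (Covers-map ts) s) h
  -- For a negative sign, `OnlyPol` at this occurrence is `j ≢ j`.
  ... | false | j≢j | _  = ⊥-elim (j≢j refl)
  Sat-transfer (eq x y) _ _ _ _ s _ h = proj₁ (proj₂ (s x y)) h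
  Sat-transfer {q} {q′} (neg φ) w w′ sign pol s t h h′ =
    h (Sat-transfer {q′} {q} φ w′ w (not ∘ sign) pol (Sim-sym {q} {q′} s)
                    (λ j → SignedTransfers-not (sign j) (t j)) h′)
  Sat-transfer (and φ ψ) w w′ sign pol s t (h₁ , h₂) =
    Sat-transfer φ (m⊔n<o⇒m<o _ _ w) (m⊔n<o⇒m<o _ _ w′) sign (proj₁ ∘ pol) s t h₁ ,
    Sat-transfer ψ (m⊔n<o⇒n<o (width φ) _ w) (m⊔n<o⇒n<o (width φ) _ w′) sign (proj₂ ∘ pol) s t h₂
  Sat-transfer (or φ ψ) w w′ sign pol s t = Sum.map
    (Sat-transfer φ (m⊔n<o⇒m<o _ _ w) (m⊔n<o⇒m<o _ _ w′) sign (proj₁ ∘ pol) s t)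
    (Sat-transfer ψ (m⊔n<o⇒n<o (width φ) _ w) (m⊔n<o⇒n<o (width φ) _ w′) sign (proj₂ ∘ pol) s t)
  Sat-transfer {q} {q′} (ex {v} φ) w w′ sign pol s t (a , h)
    with Sim-forth {q} {q′} (m⊔n<o⇒m<o v _ w′) s a
  ... | a′ , s′ = a′ ,
    Sat-transfer φ (m⊔n<o⇒n<o v _ w) (m⊔n<o⇒n<o v _ w′) sign pol s′
      (λ j → SignedTransfers-mono (sign j) (λ x → suc x , refl , refl) (t j)) h
  Sat-transfer {q} {q′} (all {v} φ) w w′ sign pol s t h a′
    with Sim-back {q} {q′} (m⊔n<o⇒m<o v _ w) s a′
  ... | a , s′ =
    Sat-transfer φ (m⊔n<o⇒n<o v _ w) (m⊔n<o⇒n<o v _ w′) sign pol s′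
      (λ j → SignedTransfers-mono (sign j) (λ x → suc x , refl , refl) (t j)) (h a)
  -- A prefixed point S′ on the right pulls back to the prefixed point of all tuples
  -- whose every similar tuple is in S′.
  Sat-transfer {q} {q′} (lfp k φ pos-φ ts) w w′ sign pol {ρ} {ρ′} s {R} {R′} t h S′ S′-closed =
    S⇒S′ (Vec.map ρ ts) (Vec.map ρ′ ts) (Sim-mono {q} {q′} (Covers-map ts) s) (h S S-closed)
    where
    P? = λ as → allVec? k λ as′ → Sim? {q} {q′} (as ⊕ ρ) (as′ ⊕ ρ′) →-dec (S′ as′ Bool.≟ true)
    S = does ∘ P?
    S⇒S′ : Transfers {q} {q′} ρ ρ′ S S′
    S⇒S′ as as′ s′ h′ with P? as
    ... | yes p = p as′ s′
    sign′ : Fin (suc _) → Bool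
    sign′ zero    = true
    sign′ (suc j) = sign j
    pol′ : ∀ j → OnlyPol (sign′ j) j φ
    pol′ zero    = pos-φ
    pol′ (suc j) = pol j
    S-closed : ∀ as → Sat (lasso q) φ (as ⊕ ρ) (extR S R) → S as ≡ true
    S-closed as h′ = dec-true (P? as) λ as′ s′ → S′-closed as′
      (Sat-transfer φ w w′ sign′ pol′ s′
        (λ { zero → SignedTransfers-mono true {q} {q′} (Covers-right as as′) S⇒S′
           ; (suc j) → SignedTransfers-mono (sign j) (Covers-right as as′) (t j) }) h′)

K-undefinable : ¬ FOLFPDefinable (λ {n} → K {n})
K-undefinable (φ , def) =
  lasso∉K m (Equivalence.from (def _)
    (Sat-transfer m φ (m<n+m m (s≤s z≤n)) (m<n+m m (s≤s z≤n)) (λ ()) (λ ()) (λ ()) (λ ())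
      (Equivalence.to (def _) (lasso∈K m))))
  where m = width φ

-- The search machine

-- The tape is dollar, n vertex cells, the row of U, the rows of E, and blanks.  The vertex cells
-- overwrite the unary prefix 1ⁿ0 of the code except for its first symbol, which becomes dollar.
-- A bit of the current round is done once it has been read.  The flags of a vertex cell:
-- x, the vertex was reached in an earlier round; n, it is reached in this round;
-- r and c, the current row and column; t, it has been used to count a round (two per round).
data Sym : Set where
  blank    : Sym
  bit done : Bool → Sym
  dollar   : Sym
  vtx      : (x n r c t : Bool) → Sym

-- The flag a of a state says that the current row belongs to an element reached in an earlier
-- round (or is the row of U, marked by dollar), and y that this row also has a 1 in the current
-- column.  The states resᵢ rewind the tape between rounds, having i vertices left to tick.
data St : Set where
  boot init endR res2 res1 res0 wrapL wrapA acc rej : St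
  col1 seek adv home : Bool → St
  back : (a y : Bool) → St

boolFin : Bool → Fin 2
boolFin false = zero
boolFin true  = suc zero

finBool : Fin 2 → Bool
finBool zero    = false
finBool (suc _) = true

finBool-boolFin : ∀ b → finBool (boolFin b) ≡ b
finBool-boolFin false = refl
finBool-boolFin true  = refl

encBools : ∀ {k} → Vec Bool k → Fin (2 ^ k)
encBools []       = zero
encBools (b ∷ bs) = combine (boolFin b) (encBools bs)

decBools : ∀ {k} → Fin (2 ^ k) → Vec Bool k
decBools {zero}  _ = []
decBools {suc k} i = finBool (proj₁ (remQuot {2} (2 ^ k) i)) ∷ decBools (proj₂ (remQuot {2} (2 ^ k) i))

decBools-encBools : ∀ {k} (bs : Vec Bool k) → decBools (encBools bs) ≡ bs
decBools-encBools []       = refl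
decBools-encBools {suc k} (b ∷ bs) = trans
  (cong (λ (i , j) → finBool i ∷ decBools j) (Fin.remQuot-combine (boolFin b) (encBools bs)))
  (cong₂ _∷_ (finBool-boolFin b) (decBools-encBools bs))

-- `inputTape` dictates the codes of the blank and of the two bits. The five flags of a vertex cell
-- form a binary number, which makes 6 + 2^5 symbols.
encSym : Sym → Fin 38
encSym blank        = # 0
encSym (bit false)  = # 1
encSym (bit true)   = # 2
encSym (done false) = # 3
encSym (done true)  = # 4
encSym dollar       = # 5
encSym (vtx x n r c t) = 6 ↑ʳ encBools (x ∷ n ∷ r ∷ c ∷ t ∷ [])

vtxBits : Vec Bool 5 → Sym
vtxBits (x ∷ n ∷ r ∷ c ∷ t ∷ []) = vtx x n r c t

decSym : Fin 38 → Sym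
decSym i = [ lookup (blank ∷ bit false ∷ bit true ∷ done false ∷ done true ∷ dollar ∷ [])
           , vtxBits ∘ decBools ] (splitAt 6 i)

decSym-encSym : ∀ s → decSym (encSym s) ≡ s
decSym-encSym blank        = refl
decSym-encSym (bit false)  = refl
decSym-encSym (bit true)   = refl
decSym-encSym (done false) = refl
decSym-encSym (done true)  = refl
decSym-encSym dollar       = refl
decSym-encSym (vtx x n r c t) = cong vtxBits (decBools-encBools (x ∷ n ∷ r ∷ c ∷ t ∷ []))

states : Vec St 22
states = boot ∷ init ∷ endR ∷ res2 ∷ res1 ∷ res0 ∷ wrapL ∷ wrapA ∷ acc ∷ rej ∷
         col1 false ∷ col1 true ∷ seek false ∷ seek true ∷ adv false ∷ adv true ∷
         home false ∷ home true ∷ back false false ∷ back false true ∷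
         back true false ∷ back true true ∷ []

encSt : St → Fin 22
encSt boot = # 0
encSt init  = # 1
encSt endR  = # 2
encSt res2  = # 3
encSt res1  = # 4
encSt res0  = # 5
encSt wrapL = # 6
encSt wrapA = # 7
encSt acc   = # 8
encSt rej   = # 9
encSt (col1 false) = # 10
encSt (col1 true)  = # 11
encSt (seek false) = # 12
encSt (seek true)  = # 13
encSt (adv false)  = # 14
encSt (adv true)   = # 15
encSt (home false) = # 16
encSt (home true)  = # 17
encSt (back false false) = # 18
encSt (back false true)  = # 19
encSt (back true false)  = # 20
encSt (back true true)   = # 21

decSt-encSt : ∀ q → lookup states (encSt q) ≡ q
decSt-encSt boot = refl
decSt-encSt init  = refl
decSt-encSt endR  = refl
decSt-encSt res2  = refl
decSt-encSt res1  = refl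
decSt-encSt res0  = refl
decSt-encSt wrapL = refl
decSt-encSt wrapA = refl
decSt-encSt acc   = refl
decSt-encSt rej   = refl
decSt-encSt (col1 false) = refl
decSt-encSt (col1 true)  = refl
decSt-encSt (seek false) = refl
decSt-encSt (seek true)  = refl
decSt-encSt (adv false)  = refl
decSt-encSt (adv true)   = refl
decSt-encSt (home false) = refl
decSt-encSt (home true)  = refl
decSt-encSt (back false false) = refl
decSt-encSt (back false true)  = refl
decSt-encSt (back true false)  = refl
decSt-encSt (back true true)   = refl

δ′ : St → Sym → St × Sym × Move
δ′ boot (bit true)  = init , dollar , right
δ′ boot s           = acc , s , stay
δ′ init (bit true)   = init , vtx false false false false false , right
δ′ init (bit false)  = endR , vtx false false false false false , right
δ′ init s            = rej , s , stay
δ′ endR blank        = res2 , blank , left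
δ′ endR s            = endR , s , right
δ′ res2 (bit b)      = res2 , bit b , left
δ′ res2 (done b)     = res2 , bit b , left
δ′ res2 (vtx x n r c true)  = res2 , vtx (x ∨ n) false false false true , left
δ′ res2 (vtx x n r c false) = res1 , vtx (x ∨ n) false false false true , left
-- Here and in `res1`, dollar is met before two vertices could be ticked: all n / 2 rounds are over.
δ′ res2 s            = acc , s , stay
δ′ res1 (vtx x n r c t)     = res0 , vtx (x ∨ n) false false false true , left
δ′ res1 s            = acc , s , stay
δ′ res0 (vtx x n r c t)     = res0 , vtx (x ∨ n) false false false t , left
δ′ res0 s            = col1 true , s , right
δ′ (col1 a) (vtx x n r c t) = seek a , vtx x n r true t , right
δ′ (col1 a) s        = rej , s , stay
δ′ (seek a) (bit b)  = back a (a ∧ b) , done b , left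
δ′ (seek a) s        = seek a , s , right
-- Row and column flag in one cell: the bit just read is diagonal, so it is a loop at a vertex
-- reached in an earlier round.
δ′ (back a true) (vtx x n true true t) = rej , vtx x n true true t , stay
δ′ (back a y) (vtx x n r true t) = adv a , vtx x (n ∨ y) r false t , right
δ′ (back a y) s      = back a y , s , left
δ′ (adv a) (vtx x n r c t)  = seek a , vtx x n r true t , right
δ′ (adv a) s         = wrapL , s , left
δ′ wrapL (vtx x n true c t) = wrapA , vtx x n false c t , right
δ′ wrapL dollar      = wrapA , dollar , right
δ′ wrapL s           = wrapL , s , left
δ′ wrapA (vtx x n r c t)    = home x , vtx x n true c t , left
δ′ wrapA s           = endR , s , right
δ′ (home a) dollar   = col1 a , dollar , right
δ′ (home a) s        = home a , s , left
δ′ acc s             = acc , s , stay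
δ′ rej s             = rej , s , stay

machine : TM
machine = record
  { nstates = 22
  ; extra   = 35
  ; start   = encSt boot
  ; accept  = encSt acc
  ; reject  = encSt rej
  ; δ       = λ q s → let (q′ , s′ , m) = δ′ (lookup states q) (decSym s)
                      in encSt q′ , encSym s′ , m
  }

δ-machine : ∀ q s → δ machine (encSt q) (encSym s) ≡
            (let (q′ , s′ , m) = δ′ q s in encSt q′ , encSym s′ , m)
δ-machine q s rewrite decSt-encSt q | decSym-encSym s = refl

-- Runs of the machine on zippers

Running : St → Set
Running q = halted machine (encSt q) ≡ false

-- A state together with the tape cells left of the head (nearest first) and those from
-- the head on; the rest of the tape is blank.
record Zipper : Set where
  constructor zip
  field
    st : St
    ls : List Sym
    rs : List Sym
open Zipper

size : Zipper → ℕ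
size z = length (ls z) + length (rs z)

-- Moves only lead to listed cells, so `size` is constant along a run and can serve as the unit of
-- time.
data _⟶_ : Zipper → Zipper → Set where
  →right : ∀ {q q′ s s′ d l r} → Running q → δ′ q s ≡ (q′ , s′ , right) →
           zip q l (s ∷ d ∷ r) ⟶ zip q′ (s′ ∷ l) (d ∷ r)
  →left  : ∀ {q q′ s s′ d l r} → Running q → δ′ q s ≡ (q′ , s′ , left) →
           zip q (d ∷ l) (s ∷ r) ⟶ zip q′ l (d ∷ s′ ∷ r)
  →stay  : ∀ {q q′ s s′ l r} → Running q → δ′ q s ≡ (q′ , s′ , stay) →
           zip q l (s ∷ r) ⟶ zip q′ l (s′ ∷ r)

cells : List Sym → ℕ → Fin 38
cells []       i       = zero
cells (s ∷ ss) zero    = encSym s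
cells (s ∷ ss) (suc i) = cells ss i

record _≈_ (c : Config machine) (z : Zipper) : Set where
  field
    state≡ : state c ≡ encSt (st z)
    head≡  : head c ≡ length (ls z)
    tape≗  : ∀ i → tape c i ≡ cells (ls z ʳ++ rs z) i
open _≈_

step-δ : ∀ (M : TM) (c : Config M) {q b m} → halted M (state c) ≡ false →
         δ M (state c) (tape c (head c)) ≡ (q , b , m) →
         step M c ≡ config q (move m (head c)) (write (tape c) (head c) b)
step-δ M c h d rewrite h | d = refl

write-cong : ∀ {A : Set} {f g : ℕ → A} i b → (∀ j → f j ≡ g j) → ∀ j → write f i b j ≡ write g i b j
write-cong zero    b e zero    = refl
write-cong zero    b e (suc j) = e (suc j)
write-cong (suc i) b e zero    = e zero
write-cong (suc i) b e (suc j) = write-cong i b (e ∘ suc) j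

cells-head : ∀ l s {r} → cells (l ++ s ∷ r) (length l) ≡ encSym s
cells-head []      s = refl
cells-head (_ ∷ l) s = cells-head l s

cells-write : ∀ l s s′ {r} i →
              write (cells (l ++ s ∷ r)) (length l) (encSym s′) i ≡ cells (l ++ s′ ∷ r) i
cells-write []      s s′ zero    = refl
cells-write []      s s′ (suc i) = refl
cells-write (_ ∷ l) s s′ zero    = refl
cells-write (_ ∷ l) s s′ (suc i) = cells-write l s s′ i

cells-headʳ : ∀ l s {r} → cells (l ʳ++ s ∷ r) (length l) ≡ encSym s
cells-headʳ l s {r} = trans
  (cong₂ cells (List.ʳ++-defn l) (sym (List.length-reverse l))) (cells-head (List.reverse l) s)

cells-writeʳ : ∀ l s s′ {r} i →
               write (cells (l ʳ++ s ∷ r)) (length l) (encSym s′) i ≡ cells (l ʳ++ s′ ∷ r) i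
cells-writeʳ l s s′ {r} i = trans
  (cong₂ (λ ss k → write (cells ss) k (encSym s′) i) (List.ʳ++-defn l) (sym (List.length-reverse l)))
  (trans (cells-write (List.reverse l) s s′ i) (cong (λ ss → cells ss i) (sym (List.ʳ++-defn l))))

≈-step′ : ∀ {c q q′ s s′ l r m} → c ≈ zip q l (s ∷ r) → Running q → δ′ q s ≡ (q′ , s′ , m) →
          state (step machine c) ≡ encSt q′ ×
          head (step machine c) ≡ move m (length l) ×
          (∀ i → tape (step machine c) i ≡ cells (l ʳ++ s′ ∷ r) i)
≈-step′ {c} {q} {q′} {s} {s′} {l} {r} {m} c≈z run d
  rewrite step-δ machine c (trans (cong (halted machine) (state≡ c≈z)) run)
            (trans (cong₂ (δ machine) (state≡ c≈z)
                          (trans (tape≗ c≈z _) (trans (cong (cells (l ʳ++ s ∷ r)) (head≡ c≈z)) (cells-headʳ l s))))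
                   (trans (δ-machine q s) (cong (λ (q′ , s′ , m) → encSt q′ , encSym s′ , m) d)))
  | head≡ c≈z
  = refl , refl , λ i → trans (write-cong (length l) _ (tape≗ c≈z) i) (cells-writeʳ l s s′ i)

≈-step : ∀ {c z z′} → c ≈ z → z ⟶ z′ → step machine c ≈ z′
≈-step c≈z (→right r d) with ≈-step′ c≈z r d
... | a , b , c = record { state≡ = a ; head≡ = b ; tape≗ = c }
≈-step c≈z (→left r d) with ≈-step′ c≈z r d
... | a , b , c = record { state≡ = a ; head≡ = b ; tape≗ = c }
≈-step c≈z (→stay r d) with ≈-step′ c≈z r d
... | a , b , c = record { state≡ = a ; head≡ = b ; tape≗ = c }

data Steps : ℕ → Zipper → Zipper → Set where
  []  : ∀ {z} → Steps 0 z z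
  _∷_ : ∀ {n z z′ z″} → z ⟶ z′ → Steps n z′ z″ → Steps (suc n) z z″

_++ₛ_ : ∀ {m n z z′ z″} → Steps m z z′ → Steps n z′ z″ → Steps (m + n) z z″
[]       ++ₛ ts = ts
(s ∷ ss) ++ₛ ts = s ∷ (ss ++ₛ ts)

run-Steps : ∀ {c n z z′} → c ≈ z → Steps n z z′ → run machine n c ≈ z′
run-Steps c≈z []       = c≈z
run-Steps c≈z (s ∷ ss) = run-Steps (≈-step c≈z s) ss

run-halted : ∀ M n (c : Config M) → halted M (state c) ≡ true → run M n c ≡ c
run-halted M zero    c h = refl
run-halted M (suc n) c h = trans (cong (run M n) step-halted) (run-halted M n c h)
  where
  step-halted : step M c ≡ c
  step-halted rewrite h = refl

run-+ : ∀ M m n (c : Config M) → run M (m + n) c ≡ run M n (run M m c)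
run-+ M zero    n c = refl
run-+ M (suc m) n c = run-+ M m n (step M c)

⟶-size : ∀ {z z′} → z ⟶ z′ → size z′ ≡ size z
⟶-size (→right {l = l} _ _) = sym (+-suc (length l) _)
⟶-size (→left {l = l} _ _)  = +-suc (length l) _
⟶-size (→stay _ _)          = refl

Steps-size : ∀ {n z z′} → Steps n z z′ → size z′ ≡ size z
Steps-size []       = refl
Steps-size (s ∷ ss) = trans (Steps-size ss) (⟶-size s)

-- z ⇒[ k ] z′: z′ is reached within the time of k sweeps over the visited part of the tape.
record _⇒[_]_ (z : Zipper) (k : ℕ) (z′ : Zipper) : Set where
  constructor within
  field
    {time}  : ℕ
    time≤   : time ≤ k * size z
    steps   : Steps time z z′

infixr 4 _then_

_then_ : ∀ {k l z z′ z″} → z ⇒[ k ] z′ → z′ ⇒[ l ] z″ → z ⇒[ k + l ] z″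
_then_ {k} {l} {z} (within m≤ ss) (within n≤ ts) = within
  (≤-trans (+-mono-≤ m≤ (≤-trans n≤ (≤-reflexive (cong (l *_) (Steps-size ss)))))
           (≤-reflexive (sym (*-distribʳ-+ (size z) k l))))
  (ss ++ₛ ts)

⇒-weaken : ∀ {k l z z′} → k ≤ l → z ⇒[ k ] z′ → z ⇒[ l ] z′
⇒-weaken {z = z} k≤l (within n≤ ss) = within (≤-trans n≤ (*-monoˡ-≤ (size z) k≤l)) ss

one : ∀ {z z′} → z ⟶ z′ → z ⇒[ 1 ] z′
one {z} s = within (≤-trans (nonempty s) (≤-reflexive (sym (+-identityʳ (size z))))) (s ∷ [])
  where
  nonempty : ∀ {z z′} → z ⟶ z′ → 1 ≤ size z
  nonempty (→right {l = l} _ _) = ≤-trans (s≤s z≤n) (m≤n+m _ (length l))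
  nonempty (→left _ _)          = s≤s z≤n
  nonempty (→stay {l = l} _ _)  = ≤-trans (s≤s z≤n) (m≤n+m _ (length l))

Passes : St → Move → (Sym → Sym) → List Sym → Set
Passes q m f = All (λ s → δ′ q s ≡ (q , f s , m))

sweepʳ : ∀ {q f} → Running q → ∀ M {l d r} → Passes q right f M →
         zip q l (M ++ d ∷ r) ⇒[ 1 ] zip q (List.map f M ʳ++ l) (d ∷ r)
sweepʳ {q} {f} run M {l} {d} {r} ps = within bound (go M ps)
  where
  go : ∀ M {l} → Passes q right f M →
       Steps (length M) (zip q l (M ++ d ∷ r)) (zip q (List.map f M ʳ++ l) (d ∷ r))
  go []          []       = []
  go (s ∷ [])    (p ∷ ps) = →right run p ∷ go [] ps
  go (s ∷ t ∷ M) (p ∷ ps) = →right run p ∷ go (t ∷ M) ps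
  bound : length M ≤ 1 * size (zip q l (M ++ d ∷ r))
  bound rewrite List.length-++ M {d ∷ r} | +-identityʳ (length l + (length M + suc (length r))) =
    ≤-trans (m≤m+n (length M) _) (m≤n+m _ (length l))

-- The configuration after moving left off the first cell of r.
pop : St → List Sym → List Sym → Zipper
pop q []      r = zip q [] r
pop q (s ∷ l) r = zip q l (s ∷ r)

sweepˡ′ : ∀ {q f} → Running q → ∀ M {d l r} → Passes q left f M →
          pop q (M ++ d ∷ l) r ⇒[ 1 ] zip q l (d ∷ (List.map f M ʳ++ r))
sweepˡ′ {q} {f} run M {d} {l} {r} ps = within (bound M) (go M ps)
  where
  go : ∀ M {r} → Passes q left f M →
       Steps (length M) (pop q (M ++ d ∷ l) r) (zip q l (d ∷ (List.map f M ʳ++ r)))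
  go []          []       = []
  go (s ∷ [])    (p ∷ ps) = →left run p ∷ go [] ps
  go (s ∷ t ∷ M) (p ∷ ps) = →left run p ∷ go (t ∷ M) ps
  bound : ∀ M → length M ≤ 1 * size (pop q (M ++ d ∷ l) r)
  bound []      = z≤n
  bound (s ∷ M) rewrite List.length-++ M {d ∷ l}
    | +-identityʳ (length M + suc (length l) + suc (length r)) =
    ≤-trans (≤-trans (≤-reflexive (+-comm 1 (length M))) (+-monoʳ-≤ (length M) (s≤s z≤n)))
            (m≤m+n (length M + suc (length l)) _)

sweepˡ : ∀ {q f} → Running q → ∀ M {d l r} → Passes q left f M →
         pop q (M ʳ++ d ∷ l) r ⇒[ 1 ] zip q l (d ∷ (List.map f M ++ r))
sweepˡ {q} {f} run M {d} {l} {r} ps =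
  subst₂ (λ L R → pop q L r ⇒[ 1 ] zip q l (d ∷ R))
    (sym (List.ʳ++-defn M)) map-reverse-ʳ++
    (sweepˡ′ run (List.reverse M) (All.tabulate λ i → All.lookup ps (reverse⁻ i)))
  where
  reverse⁻ : ∀ {s} → s ∈ List.reverse M → s ∈ M
  reverse⁻ = Any.reverse⁻
  map-reverse-ʳ++ : List.map f (List.reverse M) ʳ++ r ≡ List.map f M ++ r
  map-reverse-ʳ++ = trans (cong (_ʳ++ r) (List.reverse-map f M))
             (trans (List.ʳ++-defn (List.reverse (List.map f M)))
                    (cong (_++ r) (List.reverse-involutive (List.map f M))))

-- Processing a row of bits

Reaches : St → Zipper → ℕ → Set
Reaches q z k = ∃₂ λ l r → z ⇒[ k ] zip q l r

NonEmpty : List Sym → Set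
NonEmpty ss = 0 < length ss

++-nonEmpty : ∀ xs {ys} → NonEmpty ys → NonEmpty (xs ++ ys)
++-nonEmpty []       h = h
++-nonEmpty (_ ∷ xs) h = s≤s z≤n

ʳ++-nonEmpty : ∀ xs {ys} → NonEmpty ys → NonEmpty (xs ʳ++ ys)
ʳ++-nonEmpty []       h = h
ʳ++-nonEmpty (_ ∷ xs) h = ʳ++-nonEmpty xs (s≤s z≤n)

right-step : ∀ {q q′ s s′ l r} → Running q → δ′ q s ≡ (q′ , s′ , right) → NonEmpty r →
             zip q l (s ∷ r) ⇒[ 1 ] zip q′ (s′ ∷ l) r
right-step {r = _ ∷ _} run d _ = one (→right run d)

left-step : ∀ {q q′ s s′ l r} → Running q → δ′ q s ≡ (q′ , s′ , left) → NonEmpty l →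
            zip q l (s ∷ r) ⇒[ 1 ] pop q′ l (s′ ∷ r)
left-step {l = _ ∷ _} run d _ = one (→left run d)

run-seek : ∀ a → Running (seek a)
run-seek false = refl
run-seek true  = refl

run-adv : ∀ a → Running (adv a)
run-adv false = refl
run-adv true  = refl

run-home : ∀ a → Running (home a)
run-home false = refl
run-home true  = refl

run-col1 : ∀ a → Running (col1 a)
run-col1 false = refl
run-col1 true  = refl

run-back : ∀ a y → Running (back a y)
run-back false false = refl
run-back false true  = refl
run-back true  false = refl
run-back true  true  = refl

-- A vertex cell without column cursor together with the bit of the current row in its column.
record Cell : Set where
  constructor cell
  field
    {oldᶜ newᶜ rowᶜ tickᶜ} : Bool
    bitᶜ : Bool
open Cell

plain cursor : Cell → Sym
plain  c = vtx (oldᶜ c) (newᶜ c) (rowᶜ c) false (tickᶜ c)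
cursor c = vtx (oldᶜ c) (newᶜ c) (rowᶜ c) true (tickᶜ c)

updated : Bool → Cell → Sym
updated a c = vtx (oldᶜ c) (newᶜ c ∨ (a ∧ bitᶜ c)) (rowᶜ c) false (tickᶜ c)

hit : Bool → Cell → Bool
hit a c = (a ∧ bitᶜ c) ∧ rowᶜ c

back-plain : ∀ a y c → δ′ (back a y) (plain c) ≡ (back a y , plain c , left)
back-plain a false c = refl
back-plain a true (cell {rowᶜ = false} _) = refl
back-plain a true (cell {rowᶜ = true} _)  = refl

back-done : ∀ a y b → δ′ (back a y) (done b) ≡ (back a y , done b , left)
back-done a false b = refl
back-done a true  b = refl

back-cursor : ∀ a c → hit a c ≡ false →
              δ′ (back a (a ∧ bitᶜ c)) (cursor c) ≡ (adv a , updated a c , right)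
back-cursor a c h with a ∧ bitᶜ c
... | false = refl
back-cursor a (cell {rowᶜ = false} _) h | true = refl

back-hit : ∀ a c → hit a c ≡ true →
           δ′ (back a (a ∧ bitᶜ c)) (cursor c) ≡ (rej , cursor c , stay)
back-hit a c h with a ∧ bitᶜ c
back-hit a (cell {rowᶜ = true} _) h | true = refl

sweepʳ-id : ∀ {q} → Running q → ∀ M {l d r} → Passes q right id M →
            zip q l (M ++ d ∷ r) ⇒[ 1 ] zip q (M ʳ++ l) (d ∷ r)
sweepʳ-id {q} run M {l} {d} {r} ps =
  subst (λ N → zip q l (M ++ d ∷ r) ⇒[ 1 ] zip q (N ʳ++ l) (d ∷ r)) (List.map-id M) (sweepʳ run M ps)

sweepˡ-id : ∀ {q} → Running q → ∀ M {d l r} → Passes q left id M →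
            pop q (M ʳ++ d ∷ l) r ⇒[ 1 ] zip q l (d ∷ (M ++ r))
sweepˡ-id {q} run M {d} {l} {r} ps =
  subst (λ N → pop q (M ʳ++ d ∷ l) r ⇒[ 1 ] zip q l (d ∷ (N ++ r))) (List.map-id M) (sweepˡ run M ps)

cell-seek : ∀ a c M {l r} → Passes (seek a) right id M → (∀ y → Passes (back a y) left id M) →
            zip (seek a) (cursor c ∷ l) (M ++ bit (bitᶜ c) ∷ r) ⇒[ 3 ]
            zip (back a (a ∧ bitᶜ c)) l (cursor c ∷ (M ++ done (bitᶜ c) ∷ r))
cell-seek a c M pʳ pˡ =
  sweepʳ-id (run-seek a) M pʳ then
  left-step (run-seek a) refl (ʳ++-nonEmpty M (s≤s z≤n)) then
  sweepˡ-id (run-back a _) M (pˡ _)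

cell-step : ∀ a c M {l r} → Passes (seek a) right id M → (∀ y → Passes (back a y) left id M) →
            let z = zip (seek a) (cursor c ∷ l) (M ++ bit (bitᶜ c) ∷ r) in
            (hit a c ≡ true × Reaches rej z 4) ⊎
            (hit a c ≡ false × z ⇒[ 4 ] zip (adv a) (updated a c ∷ l) (M ++ done (bitᶜ c) ∷ r))
cell-step a c M pʳ pˡ with hit a c in eq
... | true  = inj₁ (refl , _ , _ ,
                (cell-seek a c M pʳ pˡ then one (→stay (run-back a _) (back-hit a c eq))))
... | false = inj₂ (refl ,
                (cell-seek a c M pʳ pˡ then
                 right-step (run-back a _) (back-cursor a c eq) (++-nonEmpty M (s≤s z≤n))))

Reaches-mono : ∀ {q z k l} → k ≤ l → Reaches q z k → Reaches q z l
Reaches-mono k≤l (_ , _ , s) = _ , _ , ⇒-weaken k≤l s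

_then′_ : ∀ {q k l z z′} → z ⇒[ k ] z′ → Reaches q z′ l → Reaches q z (k + l)
s then′ (_ , _ , t) = _ , _ , (s then t)

infixr 4 _then′_

done-snoc : ∀ ds b r → map done ds ++ done b ∷ r ≡ map done (ds ++ b ∷ []) ++ r
done-snoc ds b r = trans (sym (List.++-assoc (map done ds) _ r))
                         (cong (_++ r) (sym (List.map-++ done ds _)))

seek-passes : ∀ a cs ds → Passes (seek a) right id (map plain cs ++ map done ds)
seek-passes a cs ds = All.++⁺ (All.map⁺ (All.universal (λ _ → refl) cs))
                              (All.map⁺ (All.universal (λ _ → refl) ds))

back-passes : ∀ a y cs ds → Passes (back a y) left id (map plain cs ++ map done ds)
back-passes a y cs ds = All.++⁺ (All.map⁺ (All.universal (back-plain a y) cs))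
                                (All.map⁺ (All.universal (back-done a y) ds))

-- Each column visit marks exactly one bit, so the first unread bit on the tape always belongs to
-- the column of the cursor. The matrix is read in order without any addressing; `ds` collects the
-- bits already read.
cols : ∀ a c cs ds {l r} →
  let z = zip (seek a) (cursor c ∷ l)
              (map plain cs ++ map done ds ++ map (bit ∘ bitᶜ) (c ∷ cs) ++ r)
      k = 5 * length (c ∷ cs) in
  (Any (λ c → hit a c ≡ true) (c ∷ cs) × Reaches rej z k) ⊎
  (All (λ c → hit a c ≡ false) (c ∷ cs) ×
   z ⇒[ k ] zip (adv a) (map (updated a) (c ∷ cs) ʳ++ l) (map done (ds ++ map bitᶜ (c ∷ cs)) ++ r))
cols a c cs ds {l} {r}
  rewrite sym (List.++-assoc (map plain cs) (map done ds) (map (bit ∘ bitᶜ) (c ∷ cs) ++ r))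
  with cell-step a c (map plain cs ++ map done ds) {l} {map (bit ∘ bitᶜ) cs ++ r}
         (seek-passes a cs ds) (λ y → back-passes a y cs ds)
... | inj₁ (h , s) = inj₁ (here h , Reaches-mono (≤-trans (n≤1+n 4) (*-monoʳ-≤ 5 (s≤s z≤n))) s)
cols a c [] ds {l} {r} | inj₂ (h , s) =
  inj₂ (h ∷ [] , subst (λ R → Z ⇒[ 5 ] zip (adv a) (updated a c ∷ l) R)
                       (done-snoc ds (bitᶜ c) r) (⇒-weaken (n≤1+n 4) s))
  where Z = zip (seek a) (cursor c ∷ l) (map done ds ++ bit (bitᶜ c) ∷ r)
cols a c (c′ ∷ cs) ds {l} {r} | inj₂ (h , s) = continue (cols a c′ cs (ds ++ bitᶜ c ∷ []))
  where
  Z = zip (seek a) (cursor c ∷ l) ((map plain (c′ ∷ cs) ++ map done ds) ++ map (bit ∘ bitᶜ) (c ∷ c′ ∷ cs) ++ r)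
  Z′ = zip (seek a) (cursor c′ ∷ updated a c ∷ l)
           (map plain cs ++ map done (ds ++ bitᶜ c ∷ []) ++ map (bit ∘ bitᶜ) (c′ ∷ cs) ++ r)
  next : Z ⇒[ 5 ] Z′
  next = subst (λ R → Z ⇒[ 5 ] zip (seek a) (cursor c′ ∷ updated a c ∷ l) R)
    (trans (List.++-assoc (map plain cs) (map done ds) _)
           (cong (map plain cs ++_) (done-snoc ds (bitᶜ c) _)))
    (s then right-step (run-adv a) refl (++-nonEmpty (map plain cs ++ map done ds) (s≤s z≤n)))
  5+ : ∀ m → 5 + 5 * m ≡ 5 * suc m
  5+ m = sym (*-suc 5 m)
  continue = Sum.map
    (λ (h′ , t) → there h′ , subst (Reaches rej Z) (5+ (length (c′ ∷ cs))) (next then′ t))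
    (λ (h′ , t) → h ∷ h′ ,
      subst₂ (λ k D → Z ⇒[ k ] zip (adv a) (map (updated a) (c ∷ c′ ∷ cs) ʳ++ l) (map done D ++ r)) (5+ (length (c′ ∷ cs)))
             (List.++-assoc ds (bitᶜ c ∷ []) _) (next then t))

row : ∀ a cs ds {r} → 0 < length cs →
  let z = zip (col1 a) (dollar ∷ []) (map plain cs ++ map done ds ++ map bit (map bitᶜ cs) ++ r)
      k = 7 * length cs in
  (Any (λ c → hit a c ≡ true) cs × Reaches rej z k) ⊎
  (All (λ c → hit a c ≡ false) cs ×
   z ⇒[ k ] pop wrapL (map (updated a) cs ʳ++ dollar ∷ []) (map done (ds ++ map bitᶜ cs) ++ r))
row a (c ∷ cs) ds {r} _ = finish (cols a c cs ds)
  where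
  m = length cs
  Z = zip (col1 a) (dollar ∷ []) (map plain (c ∷ cs) ++ map done ds ++ map bit (map bitᶜ (c ∷ cs)) ++ r)
  enter : Z ⇒[ 1 ] zip (seek a) (cursor c ∷ dollar ∷ [])
            (map plain cs ++ map done ds ++ map (bit ∘ bitᶜ) (c ∷ cs) ++ r)
  enter = subst (λ R → Z ⇒[ 1 ] zip (seek a) (cursor c ∷ dollar ∷ []) (map plain cs ++ map done ds ++ R))
    (cong (_++ r) (sym (List.map-∘ (c ∷ cs))))
    (right-step (run-col1 a) refl (++-nonEmpty (map plain cs) (++-nonEmpty (map done ds) (s≤s z≤n))))
  leave : ∀ ds {L b bs} → NonEmpty L →
          zip (adv a) L (map done (ds ++ b ∷ bs) ++ r) ⇒[ 1 ] pop wrapL L (map done (ds ++ b ∷ bs) ++ r)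
  leave []       h = left-step (run-adv a) refl h
  leave (_ ∷ ds) h = left-step (run-adv a) refl h
  -- Entering and leaving the row take one sweep each; there is at least one column to absorb them,
  -- 7 = 5 + 2.
  k≤ : 1 + (5 * suc m + 1) ≤ 7 * suc m
  k≤ = ≤-trans (≤-reflexive (trans (+-comm 1 _) (+-assoc (5 * suc m) 1 1)))
         (≤-trans (+-monoʳ-≤ (5 * suc m) (*-monoʳ-≤ 2 (s≤s z≤n)))
                  (≤-reflexive (sym (*-distribʳ-+ (suc m) 5 2))))
  finish = Sum.map
    (λ (h , t) → h , Reaches-mono (≤-trans (+-monoʳ-≤ 1 (m≤m+n _ 1)) k≤) (enter then′ t))
    (λ (h , t) → h , ⇒-weaken k≤
      (enter then t then leave ds (ʳ++-nonEmpty (map (updated a) (c ∷ cs)) (s≤s z≤n))))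

stop : ∀ {z z′} → z ≡ z′ → z ⇒[ 0 ] z′
stop refl = within z≤n []

∧-true : ∀ {a b} → a ∧ b ≡ true → a ≡ true × b ≡ true
∧-true {true} {true} _ = refl , refl

-- The rows of the edge matrix

module _ {n} (A : Str σ n) where

  -- A vertex and whether its cell is ticked.
  Item : Set
  Item = Fin n × Bool

  module _ (X N : Fin n → Bool) where

    vertexSym : Item → Sym
    vertexSym it = vtx (X (proj₁ it)) (N (proj₁ it)) false false (proj₂ it)

    rowSym : Item → Sym
    rowSym it = vtx (X (proj₁ it)) (N (proj₁ it)) true false (proj₂ it)

    toCell : (r : Bool) → (Fin n → Bool) → Item → Cell
    toCell r f it = cell {X (proj₁ it)} {N (proj₁ it)} {r} {proj₂ it} (f (proj₁ it))

    no-hits : ∀ a f its → ¬ Any (λ c → hit a c ≡ true) (map (toCell false f) its)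
    no-hits a f (it ∷ its) (here h)  with trans (sym (Bool.∧-zeroʳ (a ∧ f (proj₁ it)))) h
    ... | ()
    no-hits a f (it ∷ its) (there h) = no-hits a f its h

  rowBits : List Item → Fin n → List Bool
  rowBits its x = map (λ it → E A x (proj₁ it)) its

  matrix : List Item → List Item → List Bool
  matrix its = concatMap (λ it → rowBits its (proj₁ it))

  -- `X` stays fixed while the new set grows: vertices found in a round are not sources in the same
  -- round, so a round lengthens walks by a single edge.
  accum : (X : Fin n → Bool) → List Item → (Fin n → Bool) → Fin n → Bool
  accum X []       N = N
  accum X (j ∷ js) N = accum X js (λ z → N z ∨ (X (proj₁ j) ∧ E A (proj₁ j) z))

  -- The rows of `is` have been handled, those of `js` are to come. The cost is charged to the bits
  -- of the matrix, so that the costs of the rows add up under concatenation.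
  rows : ∀ X N its is js ds → its ≡ is ++ js →
    let z = zip wrapA (map (vertexSym X N) is ʳ++ dollar ∷ [])
                (map (vertexSym X N) js ++ map done ds ++ map bit (matrix its js) ++ blank ∷ [])
        k = 12 * length (matrix its js) in
    ((∃ λ x → X x ≡ true × E A x x ≡ true) × Reaches rej z k) ⊎
    (All (λ it → X (proj₁ it) ∧ E A (proj₁ it) (proj₁ it) ≡ false) js ×
     z ⇒[ k ] zip wrapA (map (vertexSym X (accum X js N)) its ʳ++ dollar ∷ [])
                   (map done (ds ++ matrix its js) ++ blank ∷ []))
  rows X N its is [] ds its≡ = inj₂ ([] ,
    stop (cong₂ (λ I D → zip wrapA (map (vertexSym X N) I ʳ++ dollar ∷ []) (map done D ++ blank ∷ []))
           (sym (trans its≡ (List.++-identityʳ is))) (sym (List.++-identityʳ ds))))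
  rows X N its is (j ∷ js) ds its≡ = process (row a rowCells ds {R} cells≢[])
    where
    x = proj₁ j
    a = X x
    N₁ : Fin n → Bool
    N₁ z = N z ∨ (a ∧ E A x z)
    v v₁ : Item → Sym
    v  = vertexSym X N
    v₁ = vertexSym X N₁
    rb = rowBits its x
    B  = matrix its js
    R  = map bit B ++ blank ∷ []
    T  = map done ds ++ map bit (rb ++ B) ++ blank ∷ []
    c₀ = toCell X N false (E A x)
    c₁ = toCell X N true (E A x) j
    rowCells = map c₀ is ++ c₁ ∷ map c₀ js
    Z = zip wrapA (map v is ʳ++ dollar ∷ []) (map v (j ∷ js) ++ T)

    cells≢[] : 0 < length rowCells
    cells≢[] rewrite List.length-++ (map c₀ is) {c₁ ∷ map c₀ js} =
      ≤-trans (s≤s z≤n) (m≤n+m _ (length (map c₀ is)))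

    map-cells : ∀ {C : Set} (f : Cell → C) →
                map f rowCells ≡ map (f ∘ c₀) is ++ f c₁ ∷ map (f ∘ c₀) js
    map-cells f = trans (List.map-++ f (map c₀ is) _)
      (cong₂ (λ xs ys → xs ++ f c₁ ∷ ys) (sym (List.map-∘ is)) (sym (List.map-∘ js)))

    bits-cells : map bitᶜ rowCells ≡ rb
    bits-cells = trans (map-cells bitᶜ)
      (sym (trans (cong (λ I → rowBits I x) its≡) (List.map-++ _ is (j ∷ js))))

    begin-row : Z ⇒[ 3 ] zip (col1 a) (dollar ∷ [])
                  (map plain rowCells ++ map done ds ++ map bit (map bitᶜ rowCells) ++ R)
    begin-row =
      left-step refl refl (ʳ++-nonEmpty (map v is) (s≤s z≤n)) then
      sweepˡ-id (run-home a) (map v is) (All.map⁺ (All.universal (λ _ → refl) is)) then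
      right-step (run-home a) refl (++-nonEmpty (map v is) (s≤s z≤n)) then
      stop (cong (zip (col1 a) (dollar ∷ [])) (begin
        map v is ++ (rowSym X N j ∷ map v js) ++ T
          ≡⟨ List.++-assoc (map v is) _ T ⟨
        (map v is ++ rowSym X N j ∷ map v js) ++ T
          ≡⟨ cong₂ (λ P Q → P ++ map done ds ++ Q) (sym (map-cells plain))
               (trans (cong (_++ blank ∷ []) (List.map-++ bit rb B)) (List.++-assoc (map bit rb) _ _)) ⟩
        map plain rowCells ++ map done ds ++ map bit rb ++ R
          ≡⟨ cong (λ b → map plain rowCells ++ map done ds ++ map bit b ++ R) (sym bits-cells) ⟩
        map plain rowCells ++ map done ds ++ map bit (map bitᶜ rowCells) ++ R ∎))
      where open ≡-Reasoning

    end-row : pop wrapL (map (updated a) rowCells ʳ++ dollar ∷ []) (map done (ds ++ map bitᶜ rowCells) ++ R)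
              ⇒[ 2 ]
              zip wrapA (map v₁ (is ++ j ∷ []) ʳ++ dollar ∷ [])
                        (map v₁ js ++ map done (ds ++ rb) ++ R)
    end-row =
      stop (cong₂ (pop wrapL)
        (trans (cong (_ʳ++ dollar ∷ []) (map-cells (updated a)))
               (List.++-ʳ++ (map v₁ is)))
        (cong (λ b → map done (ds ++ b) ++ R) bits-cells)) then
      sweepˡ-id refl (map v₁ js) (All.map⁺ (All.universal (λ _ → refl) js)) then
      right-step refl refl (++-nonEmpty (map v₁ js) (++-nonEmpty (map done (ds ++ rb))
                             (++-nonEmpty (map bit B) (s≤s z≤n)))) then
      stop (cong (λ L → zip wrapA L (map v₁ js ++ map done (ds ++ rb) ++ R))
        (sym (trans (cong (_ʳ++ dollar ∷ []) (List.map-++ v₁ is (j ∷ []))) (List.++-ʳ++ (map v₁ is)))))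

    -- The three sweeps before a row and the two after it are charged to its columns, 12 = 5 + 7.
    row-cost : 5 + 7 * length rowCells ≤ 12 * length rowCells
    row-cost = ≤-trans (+-monoˡ-≤ (7 * length rowCells) (*-monoʳ-≤ 5 cells≢[]))
                      (≤-reflexive (sym (*-distribʳ-+ (length rowCells) 5 7)))

    cost : 5 + 7 * length rowCells + 12 * length B ≤ 12 * length (rb ++ B)
    cost = ≤-trans (+-monoˡ-≤ (12 * length B) row-cost) (≤-reflexive (begin
      12 * length rowCells + 12 * length B  ≡⟨ *-distribˡ-+ 12 (length rowCells) (length B) ⟨
      12 * (length rowCells + length B)     ≡⟨ cong (λ m → 12 * (m + length B))
                                              (trans (sym (List.length-map bitᶜ rowCells)) (cong length bits-cells)) ⟩
      12 * (length rb + length B)        ≡⟨ cong (12 *_) (List.length-++ rb) ⟨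
      12 * length (rb ++ B)              ∎))
      where open ≡-Reasoning

    cost₂ : 3 + (7 * length rowCells + (2 + 12 * length B)) ≤ 12 * length (rb ++ B)
    cost₂ = ≤-trans (≤-reflexive (begin
      3 + (7 * length rowCells + (2 + 12 * length B))  ≡⟨ cong (3 +_) (sym (+-assoc (7 * length rowCells) 2 _)) ⟩
      3 + (7 * length rowCells + 2 + 12 * length B)    ≡⟨ cong (λ m → 3 + (m + 12 * length B)) (+-comm (7 * length rowCells) 2) ⟩
      5 + 7 * length rowCells + 12 * length B          ∎)) cost
      where open ≡-Reasoning

    cost₁ : 3 + 7 * length rowCells ≤ 12 * length (rb ++ B)
    cost₁ = ≤-trans (+-monoʳ-≤ 3 (m≤m+n (7 * length rowCells) _)) cost₂

    -- Only `c₁` carries the row flag, so a hit must be in the column of `x` itself.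
    hit⇒loop : Any (λ c → hit a c ≡ true) rowCells → a ∧ E A x x ≡ true
    hit⇒loop h with Any.++⁻ (map c₀ is) h
    ... | inj₁ h′         = ⊥-elim (no-hits X N a (E A x) is h′)
    ... | inj₂ (here h′)  = proj₁ (∧-true h′)
    ... | inj₂ (there h′) = ⊥-elim (no-hits X N a (E A x) js h′)

    process : _ → _
    process (inj₁ (h , t)) = inj₁ ((x , ∧-true (hit⇒loop h)) , Reaches-mono cost₁ (begin-row then′ t))
    process (inj₂ (h , t)) = Sum.map
      (λ (p , u) → p , Reaches-mono cost₂ (begin-row then′ t then′ end-row then′ u))
      (λ (p , u) → (trans (sym (Bool.∧-identityʳ _)) (All.head (All.++⁻ʳ (map c₀ is) h)) ∷ p) ,
        ⇒-weaken (≤-trans (≤-reflexive (+-identityʳ _)) cost₂)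
          ((begin-row then t then end-row then u) then
           stop (cong (λ D → zip wrapA (map (vertexSym X (accum X js N₁)) its ʳ++ dollar ∷ [])
                                  (map done D ++ blank ∷ [])) (List.++-assoc ds rb B))))
      (rows X N₁ its (is ++ j ∷ []) js (ds ++ rb) (trans its≡ (sym (List.++-assoc is (j ∷ []) js))))

-- Rounds and the rewinding between them

∨-true : ∀ {a b} → a ∨ b ≡ true → a ≡ true ⊎ b ≡ true
∨-true {true}  _ = inj₁ refl
∨-true {false} h = inj₂ h

∨-trueˡ : ∀ {a b} → a ≡ true → a ∨ b ≡ true
∨-trueˡ refl = refl

∨-trueʳ : ∀ {a b} → b ≡ true → a ∨ b ≡ true
∨-trueʳ {a} refl = Bool.∨-zeroʳ a

-- Before round 1 all bits are unread, at the end of every round all are done; the flag lets one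
-- description of the rewinding cover both.
mark : Bool → Bool → Sym
mark false = bit
mark true  = done

unmark : Sym → Sym
unmark (vtx x n r c t) = vtx (x ∨ n) false false false t
unmark (done b)        = bit b
unmark s               = s

unmark-mark : ∀ m b → unmark (mark m b) ≡ bit b
unmark-mark false b = refl
unmark-mark true  b = refl

res2-mark : ∀ m b → δ′ res2 (mark m b) ≡ (res2 , unmark (mark m b) , left)
res2-mark false b = refl
res2-mark true  b = refl

module _ {n} (A : Str σ n) where

  none : Fin n → Bool
  none _ = false

  _∪_ : (X N : Fin n → Bool) → Fin n → Bool
  (X ∪ N) z = X z ∨ N z

  allBits : List (Item A) → List Bool
  allBits its = map (U A ∘ proj₁) its ++ matrix A its its

  end-round : ∀ d ds L → zip wrapA L (map done (d ∷ ds) ++ blank ∷ []) ⇒[ 3 ]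
                         pop res2 (map done (d ∷ ds) ʳ++ L) (blank ∷ [])
  end-round d ds L =
    right-step refl refl (++-nonEmpty (map done ds) (s≤s z≤n)) then
    sweepʳ-id refl (map done ds) (All.map⁺ (All.universal (λ _ → refl) ds)) then
    left-step refl refl (ʳ++-nonEmpty (map done ds) (s≤s z≤n))

  round : ∀ X its → 0 < length its →
    let z = zip (col1 true) (dollar ∷ [])
                (map (vertexSym A X none) its ++ map bit (allBits its) ++ blank ∷ [])
        k = 5 + 12 * length (allBits its) in
    ((∃ λ x → X x ≡ true × E A x x ≡ true) × Reaches rej z k) ⊎
    (All (λ it → X (proj₁ it) ∧ E A (proj₁ it) (proj₁ it) ≡ false) its ×
     z ⇒[ k ] pop res2 (map done (allBits its) ʳ++ map (vertexSym A X (accum A X its (U A))) its ʳ++ dollar ∷ [])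
                  (blank ∷ []))
  round X its@(i ∷ is) 0<its =
    process (row true (map c its) [] {map bit M ++ blank ∷ []} (s≤s z≤n))
    where
    c  = toCell A X none false (U A)
    v₁ = vertexSym A X (U A)
    M  = matrix A its its
    ub = map (U A ∘ proj₁) its
    Z  = zip (col1 true) (dollar ∷ []) (map (vertexSym A X none) its ++ map bit (ub ++ M) ++ blank ∷ [])

    begin-row : Z ⇒[ 0 ] zip (col1 true) (dollar ∷ [])
                  (map plain (map c its) ++ map bit (map bitᶜ (map c its)) ++ map bit M ++ blank ∷ [])
    begin-row = stop (cong₂ (λ P Q → zip (col1 true) (dollar ∷ []) (P ++ Q))
      (List.map-∘ its)
      (trans (cong (_++ blank ∷ []) (List.map-++ bit ub M))
             (trans (List.++-assoc (map bit ub) (map bit M) _)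
                    (cong (λ b → map bit b ++ map bit M ++ blank ∷ []) (List.map-∘ its)))))

    end-row : pop wrapL (map (updated true) (map c its) ʳ++ dollar ∷ [])
                        (map done (map bitᶜ (map c its)) ++ map bit M ++ blank ∷ []) ⇒[ 2 ]
              zip wrapA (dollar ∷ []) (map v₁ its ++ map done ub ++ map bit M ++ blank ∷ [])
    end-row =
      stop (cong₂ (λ P b → pop wrapL (P ʳ++ dollar ∷ []) (map done b ++ map bit M ++ blank ∷ []))
             (sym (List.map-∘ its)) (sym (List.map-∘ its))) then
      sweepˡ-id refl (map v₁ its) (All.map⁺ (All.universal (λ _ → refl) its)) then
      right-step refl refl (s≤s z≤n)

    cost : 7 * length (map c its) + (2 + (12 * length M + 3)) ≤ 5 + 12 * length (ub ++ M)
    cost = ≤-trans (≤-reflexive (begin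
      7 * length (map c its) + (2 + (12 * length M + 3))
        ≡⟨ cong₂ (λ a b → 7 * a + (2 + b)) (trans (List.length-map c its) (sym (List.length-map (U A ∘ proj₁) its)))
                 (+-comm (12 * length M) 3) ⟩
      7 * length ub + (5 + 12 * length M)   ≡⟨ +-assoc (7 * length ub) 5 (12 * length M) ⟨
      7 * length ub + 5 + 12 * length M     ≡⟨ cong (_+ 12 * length M) (+-comm (7 * length ub) 5) ⟩
      5 + (7 * length ub + 12 * length M)   ∎))
      (+-monoʳ-≤ 5 (≤-trans (+-monoˡ-≤ (12 * length M) (*-monoˡ-≤ (length ub) (m≤m+n 7 5)))
        (≤-reflexive (trans (sym (*-distribˡ-+ 12 (length ub) (length M)))
                            (cong (12 *_) (sym (List.length-++ ub)))))))
      where open ≡-Reasoning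

    process : _ → _
    -- In the row of `U`, marked by dollar, no vertex cell carries the row flag.
    process (inj₁ (h , t)) = ⊥-elim (no-hits A X none true (U A) its h)
    process (inj₂ (h , t)) = Sum.map
      (λ (p , u) → p , Reaches-mono
        (≤-trans (+-monoʳ-≤ (7 * length (map c its)) (+-monoʳ-≤ 2 (m≤m+n (12 * length M) 3))) cost)
        (begin-row then′ t then′ end-row then′ u))
      (λ (p , u) → p , ⇒-weaken cost (begin-row then t then end-row then u then end-round _ _ _))
      (rows A X (U A) its [] its ub refl)

  -- Ticks are set from the right end of the vertex cells. The unticked vertices `ar` thus form a
  -- prefix; it is kept in reverse, the next vertex to be ticked in front.
  items : List (Fin n) → List (Fin n) → List (Item A)
  items ar B = map (_, false) ar ʳ++ map (_, true) B

  module _ (X N : Fin n → Bool) (m : Bool) (bits : List Bool) where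

    roundEnd : List (Fin n) → List (Fin n) → Zipper
    roundEnd ar B =
      pop res2 (map (mark m) bits ʳ++ map (vertexSym A X N) (items ar B) ʳ++ dollar ∷ []) (blank ∷ [])

    ticked unticked ticked′ unticked′ : Fin n → Sym
    ticked x    = vertexSym A X N (x , true)
    unticked x  = vertexSym A X N (x , false)
    ticked′ x   = vertexSym A (X ∪ N) none (x , true)
    unticked′ x = vertexSym A (X ∪ N) none (x , false)

    map-items : ∀ (f : Item A → Sym) ar B →
                map f (items ar B) ≡ map (λ x → f (x , false)) ar ʳ++ map (λ x → f (x , true)) B
    map-items f ar B = trans (List.map-ʳ++ f (map (_, false) ar))
      (cong₂ _ʳ++_ (sym (List.map-∘ ar)) (sym (List.map-∘ B)))

    rewind : ∀ ar B {d l} → map unticked ar ++ dollar ∷ [] ≡ d ∷ l →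
             roundEnd ar B ⇒[ 1 ] zip res2 l (d ∷ (map ticked′ B ++ map bit bits) ++ blank ∷ [])
    rewind ar B {d} {l} eq-l =
      stop (cong (λ L → pop res2 L (blank ∷ []))
        (trans (cong (map (mark m) bits ʳ++_)
                 (trans (cong (_ʳ++ dollar ∷ []) (map-items (vertexSym A X N) ar B))
                        (trans (List.ʳ++-ʳ++ (map unticked ar))
                               (cong (map ticked B ʳ++_) eq-l))))
               (sym (List.++-ʳ++ (map ticked B))))) then
      sweepˡ refl (map ticked B ++ map (mark m) bits)
        (All.++⁺ (All.map⁺ (All.universal (λ _ → refl) B))
                 (All.map⁺ (All.universal (res2-mark m) bits))) then
      stop (cong (λ R → zip res2 l (d ∷ R ++ blank ∷ []))
        (trans (List.map-++ unmark (map ticked B) _)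
               (cong₂ _++_ (sym (List.map-∘ B))
                           (trans (sym (List.map-∘ bits)) (List.map-cong (unmark-mark m) bits)))))

    exhausted : ∀ ar B → length ar ≤ 1 → Reaches acc (roundEnd ar B) 3
    exhausted []       B _ = Reaches-mono (m≤m+n 2 1) (rewind [] B refl then′
      (_ , _ , one (→stay refl refl)))
    exhausted (x ∷ []) B _ = rewind (x ∷ []) B refl then′ one (→left refl refl) then′
      (_ , _ , one (→stay refl refl))
    exhausted (_ ∷ _ ∷ _) B (s≤s ())

    next-round : ∀ x y ar B → roundEnd (x ∷ y ∷ ar) B ⇒[ 5 ]
      zip (col1 true) (dollar ∷ [])
          (map (vertexSym A (X ∪ N) none) (items ar (y ∷ x ∷ B)) ++ map bit bits ++ blank ∷ [])
    next-round x y ar B =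
      rewind (x ∷ y ∷ ar) B refl then
      one (→left refl refl) then
      left-step refl refl (++-nonEmpty (map unticked ar) (s≤s z≤n)) then
      sweepˡ′ {f = unmark} refl (map unticked ar) (All.map⁺ (All.universal (λ _ → refl) ar)) then
      right-step refl refl (ʳ++-nonEmpty (map unmark (map unticked ar)) (s≤s z≤n)) then
      stop (cong (zip (col1 true) (dollar ∷ [])) (begin
        map unmark (map unticked ar) ʳ++ ticked′ y ∷ ticked′ x ∷ (map ticked′ B ++ map bit bits) ++ blank ∷ []
          ≡⟨ cong₂ _ʳ++_ (sym (List.map-∘ ar))
               (cong (λ R → ticked′ y ∷ ticked′ x ∷ R) (List.++-assoc (map ticked′ B) _ _)) ⟩
        map unticked′ ar ʳ++ (map ticked′ (y ∷ x ∷ B) ++ map bit bits ++ blank ∷ [])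
          ≡⟨ ʳ++-++ (map unticked′ ar) ⟩
        (map unticked′ ar ʳ++ map ticked′ (y ∷ x ∷ B)) ++ map bit bits ++ blank ∷ []
          ≡⟨ cong (_++ map bit bits ++ blank ∷ []) (sym (map-items (vertexSym A (X ∪ N) none) ar (y ∷ x ∷ B))) ⟩
        map (vertexSym A (X ∪ N) none) (items ar (y ∷ x ∷ B)) ++ map bit bits ++ blank ∷ [] ∎))
      where
      open ≡-Reasoning
      ʳ++-++ : ∀ {C : Set} (xs : List C) {ys zs} → xs ʳ++ (ys ++ zs) ≡ (xs ʳ++ ys) ++ zs
      ʳ++-++ []       = refl
      ʳ++-++ (x ∷ xs) = ʳ++-++ xs

  vertexBits : List Bool
  vertexBits = map (U A) (allFin n) ++ concatMap (λ x → map (E A x) (allFin n)) (allFin n)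

  vertices-items : ∀ ar B → map proj₁ (items ar B) ≡ ar ʳ++ B
  vertices-items ar B = trans (List.map-ʳ++ proj₁ (map (_, false) ar))
    (cong₂ _ʳ++_ (trans (sym (List.map-∘ ar)) (List.map-id ar)) (trans (sym (List.map-∘ B)) (List.map-id B)))

  allBits-vertices : ∀ {its} → map proj₁ its ≡ allFin n → allBits its ≡ vertexBits
  allBits-vertices {its} h = cong₂ _++_
    (trans (List.map-∘ its) (cong (map (U A)) h))
    (trans (sym (List.concatMap-map (rowBits A its) proj₁ its))
           (trans (cong (concatMap (rowBits A its)) h)
                  (List.concatMap-cong (λ x → trans (List.map-∘ its) (cong (map (E A x)) h)) (allFin n))))

  -- Correctness of the search

  accum⁻ : ∀ X js N z → accum A X js N z ≡ true →
           N z ≡ true ⊎ ∃ λ x → X x ≡ true × E A x z ≡ true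
  accum⁻ X []       N z h = inj₁ h
  accum⁻ X (j ∷ js) N z h with accum⁻ X js _ z h
  ... | inj₂ p = inj₂ p
  ... | inj₁ p with ∨-true {N z} p
  ...   | inj₁ q = inj₁ q
  ...   | inj₂ q = inj₂ (_ , ∧-true q)

  accum⁺ˡ : ∀ X js N z → N z ≡ true → accum A X js N z ≡ true
  accum⁺ˡ X []       N z h = h
  accum⁺ˡ X (j ∷ js) N z h = accum⁺ˡ X js _ z (∨-trueˡ h)

  accum⁺ʳ : ∀ X js N z {x} → x ∈ map proj₁ js → X x ≡ true → E A x z ≡ true → accum A X js N z ≡ true
  accum⁺ʳ X (j ∷ js) N z (here refl) p e = accum⁺ˡ X js _ z (∨-trueʳ {N z} (cong₂ _∧_ p e))
  accum⁺ʳ X (j ∷ js) N z (there i)   p e = accum⁺ʳ X js _ z i p e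

  Outcome : Zipper → ℕ → Set
  Outcome z k = (K A × Reaches acc z k) ⊎ (¬ K A × Reaches rej z k)

  -- After k rounds.
  record Invariant (X N : Fin n → Bool) (k : ℕ) : Set where
    field
      sound    : ∀ z → X z ∨ N z ≡ true → ∃ λ ℓ → ℓ < k × Reach A ℓ z
      complete : ∀ z ℓ → ℓ < k → Reach A ℓ z → X z ∨ N z ≡ true
      loopless : ∀ z ℓ → 2 + ℓ ≤ k → Reach A ℓ z → E A z z ≡ true → ⊥

  -- The loops tested in this round are those on `X ∪ N`, reached by walks of fewer than `k` edges;
  -- so `loopless` trails `complete` by one round.
  invariant-suc : ∀ {X N k} its → map proj₁ its ≡ allFin n →
    All (λ it → (X ∪ N) (proj₁ it) ∧ E A (proj₁ it) (proj₁ it) ≡ false) its →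
    Invariant X N k → Invariant (X ∪ N) (accum A (X ∪ N) its (U A)) (suc k)
  invariant-suc {X} {N} {k} its vs no-loop inv = record
    { sound = sound′ ; complete = complete′ ; loopless = loopless′ }
    where
    open Invariant inv
    X′ = X ∪ N
    ∈its : ∀ x → x ∈ map proj₁ its
    ∈its x = subst (x ∈_) (sym vs) (∈-allFin x)
    sound′ : ∀ z → X′ z ∨ accum A X′ its (U A) z ≡ true → ∃ λ ℓ → ℓ < suc k × Reach A ℓ z
    sound′ z h with ∨-true {X′ z} h
    ... | inj₁ p with sound z p
    ...   | ℓ , ℓ<k , r = ℓ , m≤n⇒m≤1+n ℓ<k , r
    sound′ z h | inj₂ p with accum⁻ X′ its (U A) z p
    ...   | inj₁ u = 0 , s≤s z≤n , source u
    ...   | inj₂ (x , q , e) with sound x q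
    ...     | ℓ , ℓ<k , r = suc ℓ , s≤s ℓ<k , edge r e
    complete′ : ∀ z ℓ → ℓ < suc k → Reach A ℓ z → X′ z ∨ accum A X′ its (U A) z ≡ true
    complete′ z _ _         (source u) = ∨-trueʳ {X′ z} (accum⁺ˡ X′ its (U A) z u)
    complete′ z _ (s≤s ℓ<k) (edge {x = x} r e) =
      ∨-trueʳ {X′ z} (accum⁺ʳ X′ its (U A) z (∈its x) (complete x _ ℓ<k r) e)
    loopless′ : ∀ z ℓ → 2 + ℓ ≤ suc k → Reach A ℓ z → E A z z ≡ true → ⊥
    loopless′ z ℓ (s≤s ℓ<k) r e with trans (sym (All.lookup (All.map⁺ {f = proj₁} no-loop) (∈its z)))
                                          (cong₂ _∧_ (complete z ℓ ℓ<k r) e)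
    ... | ()

  -- Five sweeps for `next-round`, and five plus twelve per bit for `round`.
  roundCost : ℕ
  roundCost = 10 + 12 * length vertexBits

  -- With at most one vertex unticked, `k` is n / 2 rounded down, so the rounds cover every ℓ with
  -- `2 * (2 + ℓ) ≤ n`.
  exhausted∈K : ∀ {X N a k} → a ≤ 1 → a + 2 * k ≡ n → Invariant X N k → K A
  exhausted∈K {a = a} {k} a≤1 len inv ℓ z 2ℓ≤n r e =
    Invariant.loopless inv z ℓ (≮⇒≥ λ k<2+ℓ → <-irrefl refl (begin-strict
      1 + 2 * k      <⟨ ≤-reflexive (sym (*-suc 2 k)) ⟩
      2 * suc k      ≤⟨ *-monoʳ-≤ 2 k<2+ℓ ⟩
      2 * (2 + ℓ)    ≤⟨ 2ℓ≤n ⟩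
      n              ≡⟨ len ⟨
      a + 2 * k      ≤⟨ +-monoˡ-≤ (2 * k) a≤1 ⟩
      1 + 2 * k      ∎)) r e
    where open ≤-Reasoning

  -- Round `suc k` has ticked its own two vertices, so `2 * suc k ≤ n`, and `sound` supplies a walk
  -- with ℓ < k, hence 2 + ℓ ≤ `suc k`.
  loop∉K : ∀ {X N a k x} → a + 2 * suc k ≡ n → Invariant X N k →
           (X ∪ N) x ≡ true → E A x x ≡ true → ¬ K A
  loop∉K {a = a} {k} len inv p e kA with Invariant.sound inv _ p
  ... | ℓ , ℓ<k , r = kA ℓ _ (≤-trans (*-monoʳ-≤ 2 (s≤s ℓ<k))
                              (≤-trans (m≤n+m (2 * suc k) a) (≤-reflexive len))) r e

  exhausted-cost : ∀ a → 3 ≤ suc a * roundCost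
  exhausted-cost a = ≤-trans (m≤m+n 3 _) (m≤m+n roundCost _)

  Outcome-mono : ∀ {z k l} → k ≤ l → Outcome z k → Outcome z l
  Outcome-mono k≤l = Sum.map (map₂ (Reaches-mono k≤l)) (map₂ (Reaches-mono k≤l))

  _thenOutcome_ : ∀ {z z′ k l} → z ⇒[ k ] z′ → Outcome z′ l → Outcome z (k + l)
  s thenOutcome o = Sum.map (map₂ (s then′_)) (map₂ (s then′_)) o

  search : ∀ m X N ar B k → ar ʳ++ B ≡ allFin n → length ar + 2 * k ≡ n → Invariant X N k →
           Outcome (roundEnd X N m vertexBits ar B) (suc (length ar) * roundCost)
  search m X N []       B k _ len inv = inj₁ (exhausted∈K z≤n len inv ,
    Reaches-mono (exhausted-cost 0) (exhausted X N m vertexBits [] B z≤n))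
  search m X N (x ∷ []) B k _ len inv = inj₁ (exhausted∈K ≤-refl len inv ,
    Reaches-mono (exhausted-cost 1) (exhausted X N m vertexBits (x ∷ []) B ≤-refl))
  search m X N (x ∷ y ∷ ar) B k all≡ len inv =
    -- A round uses up two vertices but costs one `roundCost`; the other is slack.
    Outcome-mono (+-monoʳ-≤ roundCost (m≤n+m _ roundCost))
      (next-round X N m vertexBits x y ar B thenOutcome process round′)
    where
    its = items ar (y ∷ x ∷ B)
    vs : map proj₁ its ≡ allFin n
    vs = trans (vertices-items ar (y ∷ x ∷ B)) all≡
    X′ N′ : Fin n → Bool
    X′ = X ∪ N
    N′ = accum A X′ its (U A)
    0<its : 0 < length its
    0<its rewrite List.length-ʳ++ (map (_, false) ar) {map (_, true) (y ∷ x ∷ B)} =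
      ≤-trans (s≤s z≤n) (m≤n+m _ (length (map (_, false) ar)))
    Z : List Bool → Zipper
    Z bits = zip (col1 true) (dollar ∷ []) (map (vertexSym A X′ none) its ++ map bit bits ++ blank ∷ [])
    Result : List Bool → Set
    Result bits =
      ((∃ λ x → X′ x ≡ true × E A x x ≡ true) × Reaches rej (Z bits) (5 + 12 * length bits)) ⊎
      (All (λ it → X′ (proj₁ it) ∧ E A (proj₁ it) (proj₁ it) ≡ false) its ×
       Z bits ⇒[ 5 + 12 * length bits ] roundEnd X′ N′ true bits ar (y ∷ x ∷ B))
    round′ : Result vertexBits
    round′ = subst Result (allBits-vertices vs) (round X′ its 0<its)
    len′ : length ar + 2 * suc k ≡ n
    len′ = trans (trans (cong (length ar +_) (*-suc 2 k))
                        (trans (+-suc (length ar) _) (cong suc (+-suc (length ar) _)))) len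
    process : Result vertexBits → Outcome (Z vertexBits) (5 + 12 * length vertexBits + suc (length ar) * roundCost)
    process (inj₁ ((z , p , e) , t)) = inj₂ (loop∉K {a = length ar} len′ inv p e , Reaches-mono (m≤m+n _ _) t)
    process (inj₂ (no-loop , t)) = t thenOutcome
      search true X′ N′ ar (y ∷ x ∷ B) (suc k) all≡ len′ (invariant-suc its vs no-loop inv)

  -- Encoded inputs, initialisation and running time

  encode-vertexBits : encode A ≡ replicate n true ++ false ∷ vertexBits
  encode-vertexBits = cong (λ bs → replicate n true ++ false ∷ bs) (cong₂ _++_ unary
    (trans (List.++-identityʳ _) binary))
    where
    singles : ∀ {C D : Set} (f : C → D) xs → concatMap (λ x → f x ∷ []) xs ≡ map f xs
    singles f xs = trans (sym (List.concatMap-map (_∷ []) f xs)) (List.concatMap-pure (map f xs))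
    unary : map (rel A 𝟎) (allTuples n 1) ≡ map (U A) (allFin n)
    unary = trans (cong (map (rel A 𝟎)) (singles (_∷ []) (allFin n))) (sym (List.map-∘ (allFin n)))
    binary : map (rel A 𝟏) (allTuples n 2) ≡ concatMap (λ x → map (E A x) (allFin n)) (allFin n)
    binary = trans (List.map-concatMap (rel A 𝟏) (λ x → map (x ∷_) (allTuples n 1)) (allFin n))
      (List.concatMap-cong (λ x →
        trans (cong (λ ts → map (rel A 𝟏) (map (x ∷_) ts)) (singles (_∷ []) (allFin n)))
              (trans (sym (List.map-∘ (map (_∷ []) (allFin n)))) (sym (List.map-∘ (allFin n))))) (allFin n))

emptyInvariant : ∀ {n} (A : Str σ n) → Invariant A (none A) (none A) 0
emptyInvariant A = record
  { sound = λ _ () ; complete = λ _ _ () ; loopless = λ _ _ () }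

-- The single blank is where `endR` turns round; no run passes beyond it.
input : List Bool → Zipper
input w = zip boot [] (map bit w ++ blank ∷ [])

input-replicate : ∀ {n} (A : Str σ n) →
  Outcome A (input (replicate n true ++ false ∷ vertexBits A)) (5 + suc n * roundCost A)
input-replicate {zero} A = inj₁ ((λ { _ _ () }) , _ , _ , ⇒-weaken (s≤s z≤n) (one (→stay refl refl)))
input-replicate {suc n} A = Outcome-mono A
    (≤-reflexive (cong (λ l → 5 + suc l * roundCost A) length-ar))
    (_thenOutcome_ A initialise
      (search A false (none A) (none A) ar [] 0 (List.reverse-involutive (allFin (suc n)))
              (trans (+-identityʳ _) length-ar) (emptyInvariant A)))
  where
  bits = vertexBits A
  ar = List.reverse (allFin (suc n))
  v₀ = vtx false false false false false
  its = items A ar []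
  trues = map bit (replicate n true)
  T = map bit bits ++ blank ∷ []

  length-ar : length ar ≡ suc n
  length-ar = trans (List.length-reverse (allFin (suc n))) (List.length-tabulate id)

  map-const : ∀ {C D : Set} (d : D) (xs : List C) → map (λ _ → d) xs ≡ replicate (length xs) d
  map-const d []       = refl
  map-const d (_ ∷ xs) = cong (d ∷_) (map-const d xs)

  replicate-ʳ++ : ∀ {C : Set} k (c : C) {l} → c ∷ (replicate k c ʳ++ l) ≡ replicate k c ʳ++ (c ∷ l)
  replicate-ʳ++ zero    c = refl
  replicate-ʳ++ (suc k) c = replicate-ʳ++ k c

  vertices₀ : map (vertexSym A (none A) (none A)) its ≡ replicate (suc n) v₀
  vertices₀ = trans (map-items A (none A) (none A) false bits (vertexSym A (none A) (none A)) ar [])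
    (trans (cong (_ʳ++ []) (trans (map-const v₀ ar) (cong (λ k → replicate k v₀) length-ar)))
           (reverse-replicate (suc n)))
    where
    reverse-replicate : ∀ k → List.reverse (replicate k v₀) ≡ replicate k v₀
    reverse-replicate zero    = refl
    reverse-replicate (suc k) = trans (sym (replicate-ʳ++ k v₀)) (cong (v₀ ∷_) (reverse-replicate k))

  initialise : input (replicate (suc n) true ++ false ∷ bits) ⇒[ 5 ]
               roundEnd A (none A) (none A) false bits ar []
  initialise =
    stop (cong (λ r → zip boot [] (bit true ∷ r))
      (trans (cong (_++ blank ∷ []) (List.map-++ bit (replicate n true) _)) (List.++-assoc trues _ _))) then
    right-step refl refl (++-nonEmpty trues (s≤s z≤n)) then
    sweepʳ {f = λ _ → v₀} refl trues (All.map⁺ (All.replicate⁺ n refl)) then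
    right-step refl refl (++-nonEmpty (map bit bits) (s≤s z≤n)) then
    sweepʳ-id refl (map bit bits) (All.map⁺ (All.universal (λ _ → refl) bits)) then
    left-step refl refl (ʳ++-nonEmpty (map bit bits) (s≤s z≤n)) then
    stop (cong (λ L → pop res2 (map bit bits ʳ++ L) (blank ∷ [])) (begin
      v₀ ∷ (map (λ _ → v₀) trues ʳ++ dollar ∷ [])
        ≡⟨ cong (λ L → v₀ ∷ (L ʳ++ dollar ∷ [])) (trans (map-const v₀ trues)
             (cong (λ k → replicate k v₀) (trans (List.length-map bit (replicate n true)) (List.length-replicate n)))) ⟩
      v₀ ∷ (replicate n v₀ ʳ++ dollar ∷ [])   ≡⟨ replicate-ʳ++ n v₀ ⟩
      replicate (suc n) v₀ ʳ++ dollar ∷ []    ≡⟨ cong (_ʳ++ dollar ∷ []) vertices₀ ⟨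
      map (vertexSym A (none A) (none A)) its ʳ++ dollar ∷ [] ∎))
    where open ≡-Reasoning

input-≈ : ∀ w → initConfig machine w ≈ input w
input-≈ w = record { state≡ = refl ; head≡ = refl ; tape≗ = go w }
  where
  go : ∀ w i → inputTape w i ≡ cells (map bit w ++ blank ∷ []) i
  go []          zero    = refl
  go []          (suc i) = refl
  go (false ∷ w) zero    = refl
  go (true  ∷ w) zero    = refl
  go (b ∷ w)     (suc i) = go w i

-- Here `m` will be n + 1, `b` the number of bits and `L + 1` the tape size. Padding the lower-order
-- terms by `1 ≤ L` gives (5 + 10 + 12) * 2 = 54.
polynomial-bound : ∀ {m b L} → 1 ≤ L → m ≤ L → b ≤ L → (5 + m * (10 + 12 * b)) * (L + 1) ≤ 54 * L ^ 3 
polynomial-bound {m} {b} {L} 1≤L m≤L b≤L = begin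
  (5 + m * (10 + 12 * b)) * (L + 1)
    ≤⟨ *-mono-≤ (+-mono-≤ (*-monoʳ-≤ 5 (*-mono-≤ 1≤L 1≤L))
                          (*-mono-≤ m≤L (+-mono-≤ (*-monoʳ-≤ 10 1≤L) (*-monoʳ-≤ 12 b≤L))))
                (+-monoʳ-≤ L 1≤L) ⟩
  (5 * (L * L) + L * (10 * L + 12 * L)) * (L + L)
    ≡⟨ solve 1 (λ l → (con 5 :* (l :* l) :+ l :* (con 10 :* l :+ con 12 :* l)) :* (l :+ l)
                      := con 54 :* (l :^ 3)) refl L ⟩
  54 * L ^ 3 ∎
  where
  open ≤-Reasoning
  open +-*-Solver

time-bound : ∀ {n} (A : Str σ n) →
  (5 + suc n * roundCost A) * size (input (encode A)) ≤ 54 * length (encode A) ^ 3 + 54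
time-bound {n} A = ≤-trans
  (≤-reflexive (cong ((5 + suc n * roundCost A) *_)
    (trans (List.length-++ (map bit (encode A))) (cong (_+ 1) (List.length-map bit (encode A))))))
  (≤-trans (polynomial-bound 1≤L n<L b≤L) (m≤m+n _ 54))
  where
  L = length (encode A)
  b = length (vertexBits A)
  L≡ : L ≡ n + suc b
  L≡ = trans (cong length (encode-vertexBits A))
             (trans (List.length-++ (replicate n true)) (cong (_+ suc b) (List.length-replicate n)))
  b<L : suc b ≤ L
  b<L = ≤-trans (m≤n+m (suc b) n) (≤-reflexive (sym L≡))
  b≤L : b ≤ L
  b≤L = <⇒≤ b<L
  1≤L : 1 ≤ L
  1≤L = ≤-trans (s≤s z≤n) b<L
  n<L : suc n ≤ L
  n<L = ≤-trans (≤-trans (s≤s (m≤m+n n b)) (≤-reflexive (sym (+-suc n b)))) (≤-reflexive (sym L≡))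

halts-in : ∀ {q w k T} → halted machine (encSt q) ≡ true → Reaches q (input w) k →
           k * size (input w) ≤ T → state (run machine T (initConfig machine w)) ≡ encSt q
halts-in {q} {w} {k} {T} h (l , r , within {t} t≤ ss) k≤T with ≤-trans t≤ k≤T
... | t≤T = begin
  state (run machine T c)                 ≡⟨ cong (λ m → state (run machine m c)) (m+[n∸m]≡n t≤T) ⟨
  state (run machine (t + (T ∸ t)) c)     ≡⟨ cong state (run-+ machine t (T ∸ t) c) ⟩
  state (run machine (T ∸ t) c′)          ≡⟨ cong state (run-halted machine (T ∸ t) c′
                                               (trans (cong (halted machine) q≡) h)) ⟩
  state c′                                ≡⟨ q≡ ⟩
  encSt q                                 ∎
  where
  open ≡-Reasoning
  c = initConfig machine w
  c′ = run machine t c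
  q≡ : state c′ ≡ encSt q
  q≡ = _≈_.state≡ (run-Steps (input-≈ w) ss)

decided : ∀ {n} (A : Str σ n) {k} T → Outcome A (input (encode A)) k → k * size (input (encode A)) ≤ T →
  let q = state (run machine T (initConfig machine (encode A))) in
  halted machine q ≡ true × (K A ⇔ (q ≡ accept machine))
decided A T (inj₁ (kA , t)) k≤T =
  cong (halted machine) q≡ , mk⇔ (λ _ → q≡) (λ _ → kA)
  where q≡ = halts-in {T = T} refl t k≤T
decided A T (inj₂ (¬kA , t)) k≤T =
  cong (halted machine) q≡ , mk⇔ (λ kA → contradiction kA ¬kA) (λ h → contradiction (trans (sym q≡) h) λ ())
  where q≡ = halts-in {T = T} refl t k≤T

K-PTime : PTime (λ {n} → K {n})
K-PTime = machine , 54 , 3 , λ {n} A → decided A _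
  (subst (λ w → Outcome A (input w) (5 + suc n * roundCost A)) (sym (encode-vertexBits A)) (input-replicate A))
  (time-bound A)

theorem3 : Σ Vocab λ σ → Σ (Class σ) λ K →
    IsoClosed K × PTime K × SubstructureClosed K × ¬ FOLFPDefinable K
theorem3 = σ , (λ {n} → K {n}) , K-isoClosed , K-PTime , K-substructureClosed , K-undefinable
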